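{- Let $n>1$ and let $\mathcal{G}$ be a class of goals such that if $H$ is a head of a rule then $K\in\mathcal{G}$ for any $K\subseteq H$ (multiset inclusion). There exists no acceptable encoding for qualified answers of $\mathrm{CHR}_{n+1,t}$ in $\mathrm{CHR}_n$ for the class $\mathcal{G}$.
   Context: **CHR.** Fix a signature whose predicate symbols are split into two disjoint sets $\Pi_b$ (built-in) and $\Pi_u$ (user-defined), and a first-order theory $CT$ giving the meaning of built-ins. Built-in constraints are given by $c::=a\mid c\wedge c\mid\exists_x c$ with $a$ an atomic formula over $\Pi_b$; a user-defined constraint is an atomic formula over $\Pi_u$. Conjunctions of atomic constraints are treated as multisets; "," denotes conjunction (multiset union); ${\tt true}$ is the empty multiset of built-in constraints. $Fv(\phi)$ is the set of free variables of $\phi$, and $\exists_{ -V}\phi$ is the existential closure of $\phi$ except for the variables in $V$. $p(\bar t)=p(\bar t')$ denotes the componentwise equalities $\bar t=\bar t'$ (undefined for different predicate symbols), extended in the expected way to multisets of constraints. A simplification rule has the form $H\Leftrightarrow C\mid B$ and a propagation rule the form $H\Rightarrow C\mid B$, where the head $H$ is a nonempty multiset of user-defined constraints, the guard $C$ a multiset of built-in constraints, and the body $B$ a multiset of constraints of both kinds. A program is a finite set of rules; a goal is a multiset of constraints of both kinds. Configurations are triples $\langle G,K,d\rangle$ ($G$ the constraints still to be solved, $K$ the accumulated user-defined constraints, $d$ a built-in constraint). For a program $P$, the relation $\longrightarrow$ is the least one such that: - Solve: $\langle (c,G),K,d\rangle\longrightarrow\langle G,K,d'\rangle$ if $c$ is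 built-in and $CT\models c\wedge d\leftrightarrow d'$; - Introduce: $\langle (h,G),K,d\rangle\longrightarrow\langle G,(h,K),d\rangle$ if $h$ is user-defined; - Simplify: $\langle G,H'\wedge K,d\rangle\longrightarrow\langle B\wedge G,K,H=H'\wedge d\rangle$ if $(H\Leftrightarrow C\mid B)\in P$, $x=Fv(H)$ and $CT\models d\rightarrow\exists_x((H=H')\wedge C)$; - Propagate: $\langle G,H'\wedge K,d\rangle\longrightarrow\langle B\wedge G,H'\wedge K,H=H'\wedge d\rangle$ if $(H\Rightarrow C\mid B)\in P$, $x=Fv(H)$ and $CT\models d\rightarrow\exists_x((H=H')\wedge C)$. In Simplify and Propagate the program rule is renamed with fresh variables. The data sufficient and qualified answers of $G$ in $P$ are $$\mathcal{SA}_P(G)=\{\exists_{ -Fv(G)}d\mid\langle G,\emptyset,\emptyset\rangle\longrightarrow^*\langle\emptyset,\emptyset,d\rangle\not\longrightarrow\},\quad \mathcal{QA}_P(G)=\{\exists_{ -Fv(G)}(K\wedge d)\mid \langle G,\emptyset,\emptyset\rangle\longrightarrow^*\langle\emptyset,K,d\rangle\not\longrightarrow\}.$$ Answers are read up to logical equivalence under $CT$ with respect to built-in constraints; multiplicity of user-defined constraints matters. A data sufficient answer for the goal $G$ in $P$ is trivial if it is equal to $G$, and non trivial otherwise. **Dialects.** $\mathrm{CHR}_n$ is the CHR language where the number of atoms in the head of each rule is at most $n$. $\mathrm{CHR}_{n,t}$ consists of the $\mathrm{CHR}_n$ programs which, for any goal, have only trivial data sufficient answers and qualified answers (i.e. no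 non trivial data sufficient answers). **Acceptable encodings for qualified answers.** For a CHR (sub)language $\mathrm{CHR}_x$ let $\mathcal{P}_x$ be the set of its programs and $\mathcal{G}_x$ the set of its possible goals (the user-defined predicates of source and target languages may differ). An acceptable encoding for qualified answers of $\mathrm{CHR}_x$ into $\mathrm{CHR}_y$ for the class of goals $\mathcal{G}$ is a pair of mappings $[\![\ ]\!]:\mathcal{P}_x\to\mathcal{P}_y$ and $[\![\ ]\!]_g:\mathcal{G}_x\to\mathcal{G}_y$ such that: (1) $\mathcal{P}_x$ and $\mathcal{P}_y$ share the same $CT$; (2) for any goal $(A,B)\in\mathcal{G}_x$, $[\![A,B]\!]_g=[\![A]\!]_g,[\![B]\!]_g$, and the built-ins present in the goal are left unchanged; (3') for all $P\in\mathcal{P}_x$ and $G\in\mathcal{G}$, $\mathcal{QA}_P(G)=\mathcal{QA}_{[\![P]\!]}([\![G]\!]_g)$. -}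

module Defs where

open import Level using (Lift; 0ℓ; _⊔_) renaming (suc to lsuc)
open import Data.Nat using (ℕ; _≤_; _≟_)
open import Data.Empty using (⊥)
open import Data.Unit using (⊤)
open import Data.Product using (Σ; ∃; ∃₂; _×_; _,_; proj₁)
open import Data.Sum using (_⊎_)
open import Data.Vec using (Vec; []; _∷_)
open import Data.List as List using (List; []; _∷_; _++_; map; concatMap; filter; foldr)
open import Data.List.NonEmpty as List⁺ using (List⁺; toList)
open import Data.List.Membership.Propositional using (_∈_)
open import Data.List.Relation.Unary.All using (All)
open import Data.List.Relation.Binary.Permutation.Propositional using (_↭_)
open import Data.List.Relation.Binary.Disjoint.Propositional using (Disjoint)
open import Function using (_∘_)
open import Function.Bundles using (_⇔_; _↔_; Inverse)
open import Relation.Binary.Construct.Closure.ReflexiveTransitive using (Star)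
open import Relation.Binary.PropositionalEquality using (_≡_)
open import Relation.Nullary using (¬_; ¬?; yes; no)
open import Relation.Unary using (Pred)

Var : Set
Var = ℕ

-- `User` contains the user-defined predicate symbols of all the languages under
-- comparison; an individual language uses a subset of them (see `Language`).
record Signature : Set₁ where
  field
    Fun     : Set
    fArity  : Fun → ℕ
    BuiltIn : Set
    bArity  : BuiltIn → ℕ
    User    : Set
    uArity  : User → ℕ

module Syntax (S : Signature) where
  open Signature S

  data Term : Set where
    var : Var → Term
    fn  : (f : Fun) → Vec Term (fArity f) → Term

  infixr 6 _∧ᶜ_
  infix  7 _≐_

  -- Equality is a logical symbol, since the transitions of CHR produce equations.
  -- `true` is the empty conjunction.
  data Constraint : Set where
    true : Constraint
    atom : (b : BuiltIn) → Vec Term (bArity b) → Constraint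
    _≐_  : Term → Term → Constraint
    _∧ᶜ_ : Constraint → Constraint → Constraint
    ∃ᶜ   : Var → Constraint → Constraint

  infixr 6 _∧ᶠ_
  infixr 5 _∨ᶠ_
  infixr 4 _⇒ᶠ_

  data Formula : Set where
    ⌈_⌉  : Constraint → Formula
    ⊥ᶠ   : Formula
    _∧ᶠ_ : Formula → Formula → Formula
    _∨ᶠ_ : Formula → Formula → Formula
    _⇒ᶠ_ : Formula → Formula → Formula
    ∀ᶠ   : Var → Formula → Formula
    ∃ᶠ   : Var → Formula → Formula

  infix 4 _⇔ᶠ_
  _⇔ᶠ_ : Formula → Formula → Formula
  φ ⇔ᶠ ψ = (φ ⇒ᶠ ψ) ∧ᶠ (ψ ⇒ᶠ φ)

  Theory : Set₁
  Theory = Pred Formula 0ℓ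

  record UAtom : Set where
    constructor _·_
    field
      sym  : User
      args : Vec Term (uArity sym)
  open UAtom public

  data Item : Set where
    builtin : Constraint → Item
    user    : UAtom → Item

  -- Multisets are lists considered up to _↭_.
  Goal : Set
  Goal = List Item

  data Kind : Set where
    simplification propagation : Kind

  record Rule : Set where
    constructor rule
    field
      kind  : Kind
      head  : List⁺ UAtom
      guard : List Constraint
      body  : Goal
  open Rule public

  Program : Set
  Program = List Rule

  conj : List Constraint → Constraint
  conj = foldr _∧ᶜ_ true

  ∃ᶜ* : List Var → Constraint → Constraint
  ∃ᶜ* xs c = foldr ∃ᶜ c xs

  builtinsOf : Goal → List Constraint
  builtinsOf []              = []
  builtinsOf (builtin c ∷ G) = c ∷ builtinsOf G
  builtinsOf (user _ ∷ G)    = builtinsOf G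

  usersOf : Goal → List UAtom
  usersOf []              = []
  usersOf (builtin _ ∷ G) = usersOf G
  usersOf (user a ∷ G)    = a ∷ usersOf G

  mutual
    fvᵗ : Term → List Var
    fvᵗ (var x)   = x ∷ []
    fvᵗ (fn f ts) = fvᵗˢ ts

    fvᵗˢ : ∀ {k} → Vec Term k → List Var
    fvᵗˢ []       = []
    fvᵗˢ (t ∷ ts) = fvᵗ t ++ fvᵗˢ ts

  fvᶜ : Constraint → List Var
  fvᶜ true        = []
  fvᶜ (atom b ts) = fvᵗˢ ts
  fvᶜ (s ≐ t)     = fvᵗ s ++ fvᵗ t
  fvᶜ (c ∧ᶜ d)    = fvᶜ c ++ fvᶜ d
  fvᶜ (∃ᶜ x c)    = filter (λ y → ¬? (y ≟ x)) (fvᶜ c)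

  fvᵘ : List UAtom → List Var
  fvᵘ = concatMap (λ a → fvᵗˢ (args a))

  fvⁱ : Item → List Var
  fvⁱ (builtin c) = fvᶜ c
  fvⁱ (user a)    = fvᵗˢ (args a)

  fvᵍ : Goal → List Var
  fvᵍ = concatMap fvⁱ

  fvʳ : Rule → List Var
  fvʳ r = fvᵘ (toList (head r)) ++ concatMap fvᶜ (guard r) ++ fvᵍ (body r)

  -- Renaming by a permutation of the variables acts on bound variables too, so no
  -- capture can occur.
  module _ (π : Var ↔ Var) where
    mutual
      renᵗ : Term → Term
      renᵗ (var x)   = var (Inverse.to π x)
      renᵗ (fn f ts) = fn f (renᵗˢ ts)

      renᵗˢ : ∀ {k} → Vec Term k → Vec Term k
      renᵗˢ []       = []
      renᵗˢ (t ∷ ts) = renᵗ t ∷ renᵗˢ ts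

    renᶜ : Constraint → Constraint
    renᶜ true        = true
    renᶜ (atom b ts) = atom b (renᵗˢ ts)
    renᶜ (s ≐ t)     = renᵗ s ≐ renᵗ t
    renᶜ (c ∧ᶜ d)    = renᶜ c ∧ᶜ renᶜ d
    renᶜ (∃ᶜ x c)    = ∃ᶜ (Inverse.to π x) (renᶜ c)

    renᵘ : UAtom → UAtom
    renᵘ (p · ts) = p · renᵗˢ ts

    renⁱ : Item → Item
    renⁱ (builtin c) = builtin (renᶜ c)
    renⁱ (user a)    = user (renᵘ a)

    renʳ : Rule → Rule
    renʳ (rule k H C B) = rule k (List⁺.map renᵘ H) (map renᶜ C) (map renⁱ B)

  eqs : ∀ {k} → Vec Term k → Vec Term k → Constraint
  eqs []       []       = true
  eqs (s ∷ ss) (t ∷ ts) = s ≐ t ∧ᶜ eqs ss ts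

  -- `Equate H H′ e` : the formula H = H′ is defined and is e.  Pairing is positional;
  -- every pairing of multisets arises by permuting one of the lists.
  data Equate : List UAtom → List UAtom → Constraint → Set where
    nil  : Equate [] [] true
    cons : ∀ {p ss ts H H′ e} → Equate H H′ e →
           Equate ((p · ss) ∷ H) ((p · ts) ∷ H′) (eqs ss ts ∧ᶜ e)

module Semantics (S : Signature) where
  open Signature S
  open Syntax S

  record Structure : Set₁ where
    field
      Carrier : Set
      point   : Carrier
      ⟦_⟧f    : (f : Fun) → Vec Carrier (fArity f) → Carrier
      ⟦_⟧b    : (b : BuiltIn) → Vec Carrier (bArity b) → Set

  module _ (M : Structure) where
    open Structure M

    Valuation : Set
    Valuation = Var → Carrier

    _[_↦_] : Valuation → Var → Carrier → Valuation
    (v [ x ↦ m ]) y with y ≟ x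
    ... | yes _ = m
    ... | no  _ = v y

    mutual
      eval : Valuation → Term → Carrier
      eval v (var x)   = v x
      eval v (fn f ts) = ⟦ f ⟧f (evals v ts)

      evals : ∀ {k} → Valuation → Vec Term k → Vec Carrier k
      evals v []       = []
      evals v (t ∷ ts) = eval v t ∷ evals v ts

    satᶜ : Valuation → Constraint → Set
    satᶜ v true        = ⊤
    satᶜ v (atom b ts) = ⟦ b ⟧b (evals v ts)
    satᶜ v (s ≐ t)     = eval v s ≡ eval v t
    satᶜ v (c ∧ᶜ d)    = satᶜ v c × satᶜ v d
    satᶜ v (∃ᶜ x c)    = ∃ λ m → satᶜ (v [ x ↦ m ]) c

    sat : Valuation → Formula → Set
    sat v ⌈ c ⌉    = satᶜ v c
    sat v ⊥ᶠ       = ⊥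
    sat v (φ ∧ᶠ ψ) = sat v φ × sat v ψ
    sat v (φ ∨ᶠ ψ) = sat v φ ⊎ sat v ψ
    sat v (φ ⇒ᶠ ψ) = sat v φ → sat v ψ
    sat v (∀ᶠ x φ) = ∀ m → sat (v [ x ↦ m ]) φ
    sat v (∃ᶠ x φ) = ∃ λ m → sat (v [ x ↦ m ]) φ

    GroundAtom : Set
    GroundAtom = Σ User λ p → Vec Carrier (uArity p)

    ground : Valuation → UAtom → GroundAtom
    ground v (p · ts) = p , evals v ts

  Valid : Structure → Formula → Set
  Valid M φ = ∀ v → sat M v φ

  Model : Theory → Structure → Set
  Model CT M = ∀ φ → CT φ → Valid M φ

  infix 3 _⊨_
  _⊨_ : Theory → Formula → Set₁
  CT ⊨ φ = ∀ M → Model CT M → Valid M φ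

  Consistent : Theory → Set₁
  Consistent CT = ¬ (CT ⊨ ⊥ᶠ)

module CHR (S : Signature) (CT : Syntax.Theory S) where
  open Signature S
  open Syntax S public
  open Semantics S public

  record Config : Set where
    constructor ⟨_,_,_⟩
    field
      goal  : Goal
      store : List UAtom
      built : Constraint

  fvᶜᶠᵍ : Config → List Var
  fvᶜᶠᵍ ⟨ G , K , d ⟩ = fvᵍ G ++ fvᵘ K ++ fvᶜ d

  -- r is a variant of a rule of P whose variables are fresh for the configuration c
  -- and for V.  The list V will hold the variables of the initial goal: these must be
  -- avoided even when they no longer occur in the configuration.
  FreshVariant : Program → List Var → Config → Rule → Set
  FreshVariant P V c r =
    ∃₂ λ r₀ π → r₀ ∈ P × r ≡ renʳ π r₀ × Disjoint (fvʳ r) (V ++ fvᶜᶠᵍ c)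

  Applicable : List⁺ UAtom → List Constraint → Constraint → Constraint → Set₁
  Applicable H C e d = CT ⊨ ⌈ d ⌉ ⇒ᶠ ⌈ ∃ᶜ* (fvᵘ (toList H)) (e ∧ᶜ conj C) ⌉

  data Step (P : Program) (V : List Var) : Config → Config → Set₁ where
    solve : ∀ {G G′ K c d d′} →
      G ↭ builtin c ∷ G′ →
      CT ⊨ ⌈ c ∧ᶜ d ⌉ ⇔ᶠ ⌈ d′ ⌉ →
      Step P V ⟨ G , K , d ⟩ ⟨ G′ , K , d′ ⟩
    introduce : ∀ {G G′ K h d} →
      G ↭ user h ∷ G′ →
      Step P V ⟨ G , K , d ⟩ ⟨ G′ , h ∷ K , d ⟩
    simplify : ∀ {G K H′ K′ d e H C B} →
      K ↭ H′ ++ K′ →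
      FreshVariant P V ⟨ G , K , d ⟩ (rule simplification H C B) →
      Equate (toList H) H′ e →
      Applicable H C e d →
      Step P V ⟨ G , K , d ⟩ ⟨ B ++ G , K′ , e ∧ᶜ d ⟩
    propagate : ∀ {G K H′ K′ d e H C B} →
      K ↭ H′ ++ K′ →
      FreshVariant P V ⟨ G , K , d ⟩ (rule propagation H C B) →
      Equate (toList H) H′ e →
      Applicable H C e d →
      Step P V ⟨ G , K , d ⟩ ⟨ B ++ G , H′ ++ K′ , e ∧ᶜ d ⟩

  Final : Program → List Var → Config → Set₁
  Final P V c = ∀ c′ → ¬ Step P V c c′

  infix 4 ∃-[_]_∧_
  -- ∃-[ V ] K ∧ d : existential closure of K ∧ d except for the variables in V.
  record Answer : Set where
    constructor ∃-[_]_∧_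
    field
      keep    : List Var
      users   : List UAtom
      built   : Constraint

  goalAnswer : Goal → Answer
  goalAnswer G = ∃-[ fvᵍ G ] usersOf G ∧ conj (builtinsOf G)

  -- With user-defined constraints uninterpreted and read as multisets, an answer
  -- denotes, in a structure and for given values of its free variables, the collection
  -- of multisets of ground user-defined atoms obtained from all witnesses of the
  -- quantified variables.
  Denotes : (M : Structure) → Valuation M → Answer → List (GroundAtom M) → Set
  Denotes M v (∃-[ V ] K ∧ d) gs =
    ∃ λ θ → (∀ x → x ∈ V → θ x ≡ v x) × satᶜ M θ d × map (ground M θ) K ↭ gs

  infix 4 _≃_
  _≃_ : Answer → Answer → Set₁
  a ≃ b = ∀ M → Model CT M → ∀ v gs → Denotes M v a gs ⇔ Denotes M v b gs

  -- Sets of answers, closed under _≃_.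
  SA : Program → Goal → Pred Answer (lsuc 0ℓ)
  SA P G a = ∃ λ d →
    Star (Step P (fvᵍ G)) ⟨ G , [] , true ⟩ ⟨ [] , [] , d ⟩ ×
    Final P (fvᵍ G) ⟨ [] , [] , d ⟩ ×
    a ≃ (∃-[ fvᵍ G ] [] ∧ d)

  QA : Program → Goal → Pred Answer (lsuc 0ℓ)
  QA P G a = ∃₂ λ K d →
    Star (Step P (fvᵍ G)) ⟨ G , [] , true ⟩ ⟨ [] , K , d ⟩ ×
    Final P (fvᵍ G) ⟨ [] , K , d ⟩ ×
    a ≃ (∃-[ fvᵍ G ] K ∧ d)

  module _ (Π : Pred User 0ℓ) where
    ItemOver : Item → Set
    ItemOver (builtin _) = ⊤
    ItemOver (user a)    = Π (sym a)

    GoalOver : Goal → Set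
    GoalOver = All ItemOver

    RuleOver : Rule → Set
    RuleOver r = All (Π ∘ sym) (toList (head r)) × GoalOver (body r)

  record Language : Set₂ where
    field
      symbols   : Pred User 0ℓ
      IsProgram : Pred Program (lsuc 0ℓ)

    IsGoal : Goal → Set
    IsGoal = GoalOver symbols

    Programs : Set₁
    Programs = ∃ IsProgram

    Goals : Set
    Goals = ∃ IsGoal
  open Language public

  CHRProgram : Pred User 0ℓ → ℕ → Program → Set
  CHRProgram Π n = All λ r → RuleOver Π r × List⁺.length (head r) ≤ n

  OnlyTrivial : Pred User 0ℓ → Program → Set₁
  OnlyTrivial Π P = ∀ G → GoalOver Π G → ∀ a → SA P G a → a ≃ goalAnswer G

  CHRₙ : Pred User 0ℓ → ℕ → Language
  CHRₙ Π n = record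
    { symbols   = Π
    ; IsProgram = λ P → Lift (lsuc 0ℓ) (CHRProgram Π n P)
    }

  CHRₙ,ₜ : Pred User 0ℓ → ℕ → Language
  CHRₙ,ₜ Π n = record
    { symbols   = Π
    ; IsProgram = λ P → CHRProgram Π n P × OnlyTrivial Π P
    }

  -- 𝒢 contains every submultiset of every head of a rule of a program of L.
  ContainsSubheads : ∀ {ℓ} → Language → Pred Goal ℓ → Set (lsuc 0ℓ ⊔ ℓ)
  ContainsSubheads L 𝒢 =
    ∀ P → IsProgram L P → ∀ r → r ∈ P →
    ∀ K R → toList (head r) ↭ K ++ R → 𝒢 (map user K)

  record AcceptableEncodingQA {ℓ} (X Y : Language) (𝒢 : Pred Goal ℓ) : Set (lsuc 0ℓ ⊔ ℓ) where
    field
      ⟦_⟧  : Programs X → Programs Y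
      ⟦_⟧ᵍ : Goals X → Goals Y
      compositional : ∀ A B (A∈ : IsGoal X A) (B∈ : IsGoal X B) (AB∈ : IsGoal X (A ++ B)) →
        proj₁ ⟦ A ++ B , AB∈ ⟧ᵍ ↭ proj₁ ⟦ A , A∈ ⟧ᵍ ++ proj₁ ⟦ B , B∈ ⟧ᵍ
      builtins-unchanged : ∀ c (c∈ : IsGoal X (builtin c ∷ [])) →
        proj₁ ⟦ builtin c ∷ [] , c∈ ⟧ᵍ ↭ builtin c ∷ []
      preserves-QA : ∀ (P : Programs X) (G : Goals X) → 𝒢 (proj₁ G) → ∀ a →
        QA (proj₁ P) (proj₁ G) a ⇔ QA (proj₁ ⟦ P ⟧) (proj₁ ⟦ G ⟧ᵍ) a

-- Let P consist of the propagation rule  a, …, a ⇒ true | true  with n + 1 copies of an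
-- atom a in its head.  It can fire for ever once all copies are present, so the goal aⁿ⁺¹
-- has no qualified answer, while for k ≤ n the only answer of aᵏ is aᵏ itself.  An encoding
-- of P must thus have final derivations from ⟦a⟧ and from ⟦aⁿ⟧ with answers a and aⁿ.
-- Their local variables being renamed apart, they run side by side from ⟦aⁿ⁺¹⟧.  In the
-- configuration reached all n + 1 atoms of the store have the value of a, hence a rule with
-- at most n heads applying there would already apply to the n atoms left by ⟦aⁿ⟧, whose
-- derivation was final.  So ⟦aⁿ⁺¹⟧ has a qualified answer, although aⁿ⁺¹ has none.
module Submission where

open import Level using (0ℓ; lower)
open import Data.Nat using (ℕ; zero; suc; _+_; _∸_; _⊔_; _≤_; _<_; z≤n; s≤s; _≟_; _<?_)
open import Data.Nat.Properties
  using (suc-injective; +-suc; +-identityʳ; n≤1+n; module ≤-Reasoning; ≤-refl; ≤-trans;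
         ≤-reflexive; m≤m+n; m≤m⊔n; m≤n⊔m; <⇒≱; ≮⇒≥; m+n∸m≡n; m+[n∸m]≡n; m≤n⇒m⊓n≡m)
open import Data.Unit using (tt)
open import Data.Product using (∃; ∃₂; _×_; _,_; proj₁; proj₂)
open import Data.Sum using (_⊎_; inj₁; inj₂; [_,_]′)
open import Data.Vec as Vec using (Vec; []; _∷_)
open import Data.Product.Properties using (,-injectiveʳ-UIP)
open import Data.Vec.Properties using (∷-injective)
open import Data.List as List
  using (List; []; _∷_; _++_; map; concatMap; filter; replicate; length; take; drop)
open import Data.List.NonEmpty as List⁺ using (List⁺; toList; _∷_)
open import Data.List.Properties
  using (map-++; map-id; ++-assoc; ++-identityʳ; map-∘; map-cong; length-map; length-++;
         length-replicate; length-take; take++drop≡id; map-replicate; filter-accept;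
         filter-reject)
open import Data.List.Membership.Propositional using (_∈_; _∉_)
open import Data.List.Membership.Propositional.Properties
  using (∈-++⁺ˡ; ∈-++⁺ʳ; ∈-++⁻; ∈-filter⁺; ∈-filter⁻; ∈-map⁺; ∈-map⁻)
open import Data.List.Membership.DecPropositional _≟_ using (_∈?_)
open import Data.List.Relation.Unary.Any using (here; there)
open import Data.List.Relation.Unary.All as All using (All; []; _∷_)
import Data.List.Relation.Unary.All.Properties as Allₚ
open import Data.List.Relation.Binary.Subset.Propositional using (_⊆_)
open import Data.List.Relation.Binary.Pointwise as Pointwise using (Pointwise; []; _∷_)
open import Data.List.Relation.Binary.Permutation.Propositional
  using (_↭_; refl; prep; swap; trans; ↭-sym; ↭-trans; ↭-reflexive)
import Data.List.Relation.Binary.Permutation.Propositional.Properties as ↭ₚ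
open import Data.List.Relation.Binary.Disjoint.Propositional using (Disjoint)
open import Function using (_∘_; id)
open import Function.Bundles using (_⇔_; _↔_; Injection; Inverse; Equivalence; mk⇔; mk↔ₛ′)
open import Function.Construct.Identity using (↔-id)
open import Function.Construct.Composition using (_↔-∘_)
open import Function.Properties.Inverse using (↔⇒↣)
open import Relation.Binary.Construct.Closure.ReflexiveTransitive using (Star; ε; _◅_; _◅◅_)
open import Relation.Binary.PropositionalEquality as ≡ using (_≡_; cong; cong₂; subst)
open import Relation.Binary.PropositionalEquality.WithK using (≡-irrelevant)
open import Relation.Nullary using (¬_; Dec; yes; no; ¬?; contradiction)
open import Relation.Nullary.Decidable using (_×-dec_)
open import Relation.Unary using (Pred)
open import Defs

-- Answers are compared by denotation: the atoms left by the two target derivations need not be `a`,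
-- they only take its value under the solutions of the constraint reached. Moving a match from one
-- store to another is therefore an argument about valuations. The obstacle is the guard. It is
-- entailed by the combined constraint, but must be shown to follow from the weaker constraint left
-- by the encoding of aⁿ alone. This succeeds because the answer a has an instance under every
-- valuation: the other derivation leaves the variables of its goal unconstrained, so a solution of
-- the weaker constraint becomes a solution of the combined one by changing local variables only,
-- and neither the exchanged atoms nor the fresh rule variables notice the change. The second
-- obstacle is freshness, a syntactic condition, whereas constraints are known only up to
-- equivalence. The simulation of derivations therefore tracks free variables alongside
-- satisfaction.

to : Var ↔ Var → Var → Var
to = Inverse.to

to-injective : ∀ π {x y} → to π x ≡ to π y → x ≡ y
to-injective π = Injection.injective (↔⇒↣ π)

AgreeOn : {A : Set} → List Var → (v w : Var → A) → Set
AgreeOn xs v w = ∀ {x} → x ∈ xs → v x ≡ w x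

-- Renaming variables apart

upper-bound : ∀ xs → ∃ λ L → ∀ {x} → x ∈ xs → x < L
upper-bound []       = 0 , λ ()
upper-bound (x ∷ xs) with upper-bound xs
... | L , below = suc x ⊔ L , λ where
  (here ≡.refl) → m≤m⊔n (suc x) L
  (there y∈)    → ≤-trans (below y∈) (m≤n⊔m (suc x) L)

-- The involution exchanging x and L + x for every x < L outside V.
module Shift (V : List Var) (L : ℕ) where
  Movable : ℕ → Set
  Movable x = x < L × x ∉ V

  movable? : ∀ x → Dec (Movable x)
  movable? x = (x <? L) ×-dec ¬? (x ∈? V)

  shift : ℕ → ℕ
  shift x with movable? x
  ... | yes _ = L + x
  ... | no  _ with x <? L
  ...   | yes _ = x
  ...   | no  _ with movable? (x ∸ L)
  ...     | yes _ = x ∸ L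
  ...     | no  _ = x

  shift-up : ∀ {x} → Movable x → shift x ≡ L + x
  shift-up {x} m with movable? x
  ... | yes _ = ≡.refl
  ... | no ¬m = contradiction m ¬m

  shift-down : ∀ {x} → Movable x → shift (L + x) ≡ x
  shift-down {x} m with movable? (L + x)
  ... | yes (lt , _) = contradiction (m≤m+n L x) (<⇒≱ lt)
  ... | no _ with (L + x) <? L
  ...   | yes lt = contradiction (m≤m+n L x) (<⇒≱ lt)
  ...   | no _ with movable? (L + x ∸ L)
  ...     | yes _ = m+n∸m≡n L x
  ...     | no ¬m = contradiction (subst Movable (≡.sym (m+n∸m≡n L x)) m) ¬m

  shift-cases : ∀ x → Movable x ⊎ (∃ λ y → Movable y × x ≡ L + y) ⊎ shift x ≡ x
  shift-cases x with movable? x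
  ... | yes m = inj₁ m
  ... | no _ with x <? L
  ...   | yes _   = inj₂ (inj₂ ≡.refl)
  ...   | no  x≮L with movable? (x ∸ L)
  ...     | yes m = inj₂ (inj₁ (x ∸ L , m , ≡.sym (m+[n∸m]≡n (≮⇒≥ x≮L))))
  ...     | no _  = inj₂ (inj₂ ≡.refl)

  shift-involutive : ∀ x → shift (shift x) ≡ x
  shift-involutive x with shift-cases x
  ... | inj₁ m                        = ≡.trans (cong shift (shift-up m)) (shift-down m)
  ... | inj₂ (inj₁ (_ , m , ≡.refl)) = ≡.trans (cong shift (shift-down m)) (shift-up m)
  ... | inj₂ (inj₂ fixed)             = ≡.trans (cong shift fixed) fixed

  shift-fixes : (∀ {x} → x ∈ V → x < L) → ∀ {x} → x ∈ V → shift x ≡ x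
  shift-fixes below {x} x∈ with movable? x
  ... | yes (_ , x∉) = contradiction x∈ x∉
  ... | no _ with x <? L
  ...   | yes _   = ≡.refl
  ...   | no  x≮L = contradiction (below x∈) x≮L

-- Renamings are permutations of all variables, hence an exchange of two blocks instead of a
-- translation. Since `L` bounds `V`, `U` and `W`, a variable of `U` outside `V` lands at `L + x`,
-- beyond everything in `W`.
renaming-apart : ∀ V U W → ∃ λ π →
  (∀ {x} → x ∈ V → to π x ≡ x) × (∀ {x} → x ∈ U → x ∉ V → to π x ∉ W)
renaming-apart V U W with upper-bound (V ++ U ++ W)
... | L , below =
  mk↔ₛ′ shift shift shift-involutive shift-involutive ,
  shift-fixes (below ∘ ∈-++⁺ˡ) ,
  λ {x} x∈U x∉V πx∈W →
    <⇒≱ (below (∈-++⁺ʳ V (∈-++⁺ʳ U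
          (subst (_∈ W) (shift-up (below (∈-++⁺ʳ V (∈-++⁺ˡ x∈U)) , x∉V)) πx∈W))))
        (m≤m+n L x)
  where open Shift V L

-- Injectivity of `π` makes deletion of a bound variable commute with renaming; this is the
-- quantifier case of `fv-renᶜ`.
filter-map-≢ : ∀ π x ys →
  filter (λ y → ¬? (y ≟ to π x)) (map (to π) ys) ≡ map (to π) (filter (λ y → ¬? (y ≟ x)) ys)
filter-map-≢ π x []       = ≡.refl
filter-map-≢ π x (y ∷ ys) with y ≟ x
... | yes ≡.refl
  rewrite filter-reject (λ z → ¬? (z ≟ to π x)) {xs = map (to π) ys} (λ x≢x → x≢x ≡.refl)
        | filter-reject (λ z → ¬? (z ≟ x)) {xs = ys} (λ x≢x → x≢x ≡.refl) = filter-map-≢ π x ys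
... | no y≢x
  rewrite filter-accept (λ z → ¬? (z ≟ to π x)) {xs = map (to π) ys} (y≢x ∘ to-injective π)
        | filter-accept (λ z → ¬? (z ≟ x)) {xs = ys} y≢x = cong (to π y ∷_) (filter-map-≢ π x ys)

-- A step picks its item up to permutation; this finds the partner of that item in the embedded
-- goal.
Pointwise-↭ : ∀ {a b r} {A : Set a} {B : Set b} {R : A → B → Set r} {xs xs′ ys} →
  xs ↭ xs′ → Pointwise R xs ys → ∃ λ ys′ → ys ↭ ys′ × Pointwise R xs′ ys′
Pointwise-↭ refl         rs           = _ , refl , rs
Pointwise-↭ (prep _ p)   (r ∷ rs)     with Pointwise-↭ p rs
... | _ , q , rs′ = _ , prep _ q , r ∷ rs′
Pointwise-↭ (swap _ _ p) (r ∷ s ∷ rs) with Pointwise-↭ p rs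
... | _ , q , rs′ = _ , swap _ _ q , s ∷ r ∷ rs′
Pointwise-↭ (trans p p′) rs with Pointwise-↭ p rs
... | _ , q , rs′ with Pointwise-↭ p′ rs′
...   | _ , q′ , rs″ = _ , ↭-trans q q′ , rs″

map-fuse : ∀ {A : Set} (f g h : A → A) → (∀ x → f (g x) ≡ h x) → ∀ xs → map f (map g xs) ≡ map h xs
map-fuse f g h eq xs = ≡.trans (≡.sym (map-∘ xs)) (map-cong eq xs)

module _ (S : Signature) (CT : Syntax.Theory S) where
  open Signature S
  open CHR S CT

  -- Free variables

  concatMap-⊆ : ∀ {A : Set} (f : A → List Var) {xs ys} → xs ↭ ys → concatMap f xs ⊆ concatMap f ys
  concatMap-⊆ f refl         z∈ = z∈
  concatMap-⊆ f (prep x p)   z∈ with ∈-++⁻ (f x) z∈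
  ... | inj₁ z∈x = ∈-++⁺ˡ z∈x
  ... | inj₂ z∈p = ∈-++⁺ʳ (f x) (concatMap-⊆ f p z∈p)
  concatMap-⊆ f (swap x y p) z∈ with ∈-++⁻ (f x) z∈
  ... | inj₁ z∈x = ∈-++⁺ʳ (f y) (∈-++⁺ˡ z∈x)
  ... | inj₂ z∈r with ∈-++⁻ (f y) z∈r
  ...   | inj₁ z∈y = ∈-++⁺ˡ z∈y
  ...   | inj₂ z∈p = ∈-++⁺ʳ (f y) (∈-++⁺ʳ (f x) (concatMap-⊆ f p z∈p))
  concatMap-⊆ f (trans p q)  z∈ = concatMap-⊆ f q (concatMap-⊆ f p z∈)

  concatMap-++⁻ : ∀ {A : Set} (f : A → List Var) xs {ys} →
    concatMap f (xs ++ ys) ⊆ concatMap f xs ++ concatMap f ys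
  concatMap-++⁻ f []       z∈ = z∈
  concatMap-++⁻ f (x ∷ xs) z∈ with ∈-++⁻ (f x) z∈
  ... | inj₁ z∈x = ∈-++⁺ˡ (∈-++⁺ˡ z∈x)
  ... | inj₂ z∈r with ∈-++⁻ (concatMap f xs) (concatMap-++⁻ f xs z∈r)
  ...   | inj₁ z∈xs = ∈-++⁺ˡ (∈-++⁺ʳ (f x) z∈xs)
  ...   | inj₂ z∈ys = ∈-++⁺ʳ (f x ++ concatMap f xs) z∈ys

  concatMap-++⁺ˡ : ∀ {A : Set} (f : A → List Var) xs {ys} → concatMap f xs ⊆ concatMap f (xs ++ ys)
  concatMap-++⁺ˡ f (x ∷ xs) z∈ with ∈-++⁻ (f x) z∈
  ... | inj₁ z∈x = ∈-++⁺ˡ z∈x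
  ... | inj₂ z∈r = ∈-++⁺ʳ (f x) (concatMap-++⁺ˡ f xs z∈r)

  concatMap-++⁺ʳ : ∀ {A : Set} (f : A → List Var) xs {ys} → concatMap f ys ⊆ concatMap f (xs ++ ys)
  concatMap-++⁺ʳ f []       z∈ = z∈
  concatMap-++⁺ʳ f (x ∷ xs) z∈ = ∈-++⁺ʳ (f x) (concatMap-++⁺ʳ f xs z∈)

  fv-∃ᶜ* : ∀ xs {c} → fvᶜ (∃ᶜ* xs c) ⊆ fvᶜ c
  fv-∃ᶜ* []       z∈ = z∈
  fv-∃ᶜ* (x ∷ xs) z∈ = fv-∃ᶜ* xs (proj₁ (∈-filter⁻ (λ y → ¬? (y ≟ x)) z∈))

  fv-conj : ∀ cs → fvᶜ (conj cs) ≡ concatMap fvᶜ cs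
  fv-conj []       = ≡.refl
  fv-conj (c ∷ cs) = cong (fvᶜ c ++_) (fv-conj cs)

  fv-eqs : ∀ {k} (ss ts : Vec Term k) → fvᶜ (eqs ss ts) ⊆ fvᵗˢ ss ++ fvᵗˢ ts
  fv-eqs []       []       ()
  fv-eqs (s ∷ ss) (t ∷ ts) z∈ with ∈-++⁻ (fvᵗ s ++ fvᵗ t) z∈
  ... | inj₁ z∈st with ∈-++⁻ (fvᵗ s) z∈st
  ...   | inj₁ z∈s = ∈-++⁺ˡ (∈-++⁺ˡ z∈s)
  ...   | inj₂ z∈t = ∈-++⁺ʳ (fvᵗ s ++ fvᵗˢ ss) (∈-++⁺ˡ z∈t)
  fv-eqs (s ∷ ss) (t ∷ ts) z∈ | inj₂ z∈r with ∈-++⁻ (fvᵗˢ ss) (fv-eqs ss ts z∈r)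
  ...   | inj₁ z∈ss = ∈-++⁺ˡ (∈-++⁺ʳ (fvᵗ s) z∈ss)
  ...   | inj₂ z∈ts = ∈-++⁺ʳ (fvᵗ s ++ fvᵗˢ ss) (∈-++⁺ʳ (fvᵗ t) z∈ts)

  fv-Equate : ∀ {H H′ e} → Equate H H′ e → fvᶜ e ⊆ fvᵘ H ++ fvᵘ H′
  fv-Equate (cons {ss = ss} {ts} {H} {H′} E) z∈ with ∈-++⁻ (fvᶜ (eqs ss ts)) z∈
  ... | inj₁ z∈st with ∈-++⁻ (fvᵗˢ ss) (fv-eqs ss ts z∈st)
  ...   | inj₁ z∈s = ∈-++⁺ˡ (∈-++⁺ˡ z∈s)
  ...   | inj₂ z∈t = ∈-++⁺ʳ (fvᵗˢ ss ++ fvᵘ H) (∈-++⁺ˡ z∈t)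
  fv-Equate (cons {ss = ss} {ts} {H} {H′} E) z∈ | inj₂ z∈r with ∈-++⁻ (fvᵘ H) (fv-Equate E z∈r)
  ...   | inj₁ z∈ss = ∈-++⁺ˡ (∈-++⁺ʳ (fvᵗˢ ss) z∈ss)
  ...   | inj₂ z∈ts = ∈-++⁺ʳ (fvᵗˢ ss ++ fvᵘ H) (∈-++⁺ʳ (fvᵗˢ ts) z∈ts)

  Equate-length : ∀ {H H′ e} → Equate H H′ e → length H ≡ length H′
  Equate-length nil      = ≡.refl
  Equate-length (cons E) = cong suc (Equate-length E)

  -- Renamings

  module _ (π : Var ↔ Var) where
    mutual
      fv-renᵗ : ∀ t → fvᵗ (renᵗ π t) ≡ map (to π) (fvᵗ t)
      fv-renᵗ (var x)   = ≡.refl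
      fv-renᵗ (fn f ts) = fv-renᵗˢ ts

      fv-renᵗˢ : ∀ {k} (ts : Vec Term k) → fvᵗˢ (renᵗˢ π ts) ≡ map (to π) (fvᵗˢ ts)
      fv-renᵗˢ []       = ≡.refl
      fv-renᵗˢ (t ∷ ts) = ≡.trans (cong₂ _++_ (fv-renᵗ t) (fv-renᵗˢ ts)) (≡.sym (map-++ (to π) (fvᵗ t) _))

    fv-renᶜ : ∀ c → fvᶜ (renᶜ π c) ≡ map (to π) (fvᶜ c)
    fv-renᶜ true        = ≡.refl
    fv-renᶜ (atom b ts) = fv-renᵗˢ ts
    fv-renᶜ (s ≐ t)     = ≡.trans (cong₂ _++_ (fv-renᵗ s) (fv-renᵗ t)) (≡.sym (map-++ (to π) (fvᵗ s) _))
    fv-renᶜ (c ∧ᶜ d)    = ≡.trans (cong₂ _++_ (fv-renᶜ c) (fv-renᶜ d)) (≡.sym (map-++ (to π) (fvᶜ c) _))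
    fv-renᶜ (∃ᶜ x c)    = ≡.trans (cong (filter _) (fv-renᶜ c)) (filter-map-≢ π x (fvᶜ c))

    fv-renⁱ : ∀ i → fvⁱ (renⁱ π i) ≡ map (to π) (fvⁱ i)
    fv-renⁱ (builtin c) = fv-renᶜ c
    fv-renⁱ (user a)    = fv-renᵗˢ (args a)

    concatMap-ren : ∀ {A : Set} (ren : A → A) (f : A → List Var) →
      (∀ x → f (ren x) ≡ map (to π) (f x)) →
      ∀ xs → concatMap f (map ren xs) ≡ map (to π) (concatMap f xs)
    concatMap-ren ren f h []       = ≡.refl
    concatMap-ren ren f h (x ∷ xs) =
      ≡.trans (cong₂ _++_ (h x) (concatMap-ren ren f h xs)) (≡.sym (map-++ (to π) (f x) _))

    fv-renᵘ : ∀ H → fvᵘ (map (renᵘ π) H) ≡ map (to π) (fvᵘ H)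
    fv-renᵘ = concatMap-ren (renᵘ π) (λ a → fvᵗˢ (args a)) (λ a → fv-renᵗˢ (args a))

    fv-renᵍ : ∀ G → fvᵍ (map (renⁱ π) G) ≡ map (to π) (fvᵍ G)
    fv-renᵍ = concatMap-ren (renⁱ π) fvⁱ fv-renⁱ

    fv-renʳ : ∀ r → fvʳ (renʳ π r) ≡ map (to π) (fvʳ r)
    fv-renʳ (rule k (h ∷ hs) C B) =
      ≡.trans (cong₂ _++_ (fv-renᵘ (h ∷ hs))
                (≡.trans (cong₂ _++_ (concatMap-ren (renᶜ π) fvᶜ fv-renᶜ C) (fv-renᵍ B))
                         (≡.sym (map-++ (to π) (concatMap fvᶜ C) _))))
              (≡.sym (map-++ (to π) (fvᵘ (h ∷ hs)) _))

    ren-conj : ∀ C → renᶜ π (conj C) ≡ conj (map (renᶜ π) C)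
    ren-conj []      = ≡.refl
    ren-conj (c ∷ C) = cong (renᶜ π c ∧ᶜ_) (ren-conj C)

    ren-∃ᶜ* : ∀ xs c → renᶜ π (∃ᶜ* xs c) ≡ ∃ᶜ* (map (to π) xs) (renᶜ π c)
    ren-∃ᶜ* []       c = ≡.refl
    ren-∃ᶜ* (x ∷ xs) c = cong (∃ᶜ (to π x)) (ren-∃ᶜ* xs c)

    ren-eqs : ∀ {k} (ss ts : Vec Term k) → renᶜ π (eqs ss ts) ≡ eqs (renᵗˢ π ss) (renᵗˢ π ts)
    ren-eqs []       []       = ≡.refl
    ren-eqs (s ∷ ss) (t ∷ ts) = cong (_ ∧ᶜ_) (ren-eqs ss ts)

    ren-Equate : ∀ {H H′ e} → Equate H H′ e → Equate (map (renᵘ π) H) (map (renᵘ π) H′) (renᶜ π e)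
    ren-Equate nil = nil
    ren-Equate (cons {ss = ss} {ts} E) rewrite ren-eqs ss ts = cons (ren-Equate E)

    mutual
      ren-fixᵗ : ∀ t → AgreeOn (fvᵗ t) (to π) id → renᵗ π t ≡ t
      ren-fixᵗ (var x)   fix = cong var (fix (here ≡.refl))
      ren-fixᵗ (fn f ts) fix = cong (fn f) (ren-fixᵗˢ ts fix)

      ren-fixᵗˢ : ∀ {k} (ts : Vec Term k) → AgreeOn (fvᵗˢ ts) (to π) id → renᵗˢ π ts ≡ ts
      ren-fixᵗˢ []       fix = ≡.refl
      ren-fixᵗˢ (t ∷ ts) fix =
        cong₂ _∷_ (ren-fixᵗ t (fix ∘ ∈-++⁺ˡ)) (ren-fixᵗˢ ts (fix ∘ ∈-++⁺ʳ (fvᵗ t)))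

  module _ (ρ π : Var ↔ Var) where
    private
      σ : Var ↔ Var
      σ = π ↔-∘ ρ

    mutual
      ren-∘ᵗ : ∀ t → renᵗ π (renᵗ ρ t) ≡ renᵗ σ t
      ren-∘ᵗ (var x)   = ≡.refl
      ren-∘ᵗ (fn f ts) = cong (fn f) (ren-∘ᵗˢ ts)

      ren-∘ᵗˢ : ∀ {k} (ts : Vec Term k) → renᵗˢ π (renᵗˢ ρ ts) ≡ renᵗˢ σ ts
      ren-∘ᵗˢ []       = ≡.refl
      ren-∘ᵗˢ (t ∷ ts) = cong₂ _∷_ (ren-∘ᵗ t) (ren-∘ᵗˢ ts)

    ren-∘ᶜ : ∀ c → renᶜ π (renᶜ ρ c) ≡ renᶜ σ c
    ren-∘ᶜ true        = ≡.refl
    ren-∘ᶜ (atom b ts) = cong (atom b) (ren-∘ᵗˢ ts)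
    ren-∘ᶜ (s ≐ t)     = cong₂ _≐_ (ren-∘ᵗ s) (ren-∘ᵗ t)
    ren-∘ᶜ (c ∧ᶜ d)    = cong₂ _∧ᶜ_ (ren-∘ᶜ c) (ren-∘ᶜ d)
    ren-∘ᶜ (∃ᶜ x c)    = cong (∃ᶜ _) (ren-∘ᶜ c)

    ren-∘ᵘ : ∀ a → renᵘ π (renᵘ ρ a) ≡ renᵘ σ a
    ren-∘ᵘ (p · ts) = cong (p ·_) (ren-∘ᵗˢ ts)

    ren-∘ⁱ : ∀ i → renⁱ π (renⁱ ρ i) ≡ renⁱ σ i
    ren-∘ⁱ (builtin c) = cong builtin (ren-∘ᶜ c)
    ren-∘ⁱ (user a)    = cong user (ren-∘ᵘ a)

    -- A variant renamed once more is a variant of the same program rule, which is what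
    -- `embeds-fresh` has to exhibit.
    ren-∘ʳ : ∀ r → renʳ π (renʳ ρ r) ≡ renʳ σ r
    ren-∘ʳ (rule k (h ∷ hs) C B)
      rewrite ren-∘ᵘ h
            | map-fuse (renᵘ π) (renᵘ ρ) (renᵘ σ) ren-∘ᵘ hs
            | map-fuse (renᶜ π) (renᶜ ρ) (renᶜ σ) ren-∘ᶜ C
            | map-fuse (renⁱ π) (renⁱ ρ) (renⁱ σ) ren-∘ⁱ B = ≡.refl

  -- Satisfaction

  module _ (M : Structure) where
    open Structure M

    mutual
      eval-cong : ∀ {v w} t → AgreeOn (fvᵗ t) v w → eval M v t ≡ eval M w t
      eval-cong (var x)   h = h (here ≡.refl)
      eval-cong (fn f ts) h = cong ⟦ f ⟧f (evals-cong ts h)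

      evals-cong : ∀ {v w k} (ts : Vec Term k) → AgreeOn (fvᵗˢ ts) v w → evals M v ts ≡ evals M w ts
      evals-cong []       h = ≡.refl
      evals-cong (t ∷ ts) h = cong₂ _∷_ (eval-cong t (h ∘ ∈-++⁺ˡ)) (evals-cong ts (h ∘ ∈-++⁺ʳ (fvᵗ t)))

    update-agree : ∀ {v w : Valuation M} {x m} ys → AgreeOn (filter (λ y → ¬? (y ≟ x)) ys) v w →
      AgreeOn ys (_[_↦_] M v x m) (_[_↦_] M w x m)
    update-agree {x = x} ys h {y} y∈ with y ≟ x
    ... | yes _   = ≡.refl
    ... | no  y≢x = h (∈-filter⁺ (λ y → ¬? (y ≟ x)) y∈ y≢x)

    satᶜ-cong : ∀ {v w} c → AgreeOn (fvᶜ c) v w → satᶜ M v c → satᶜ M w c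
    satᶜ-cong true        h s = tt
    satᶜ-cong (atom b ts) h s = subst ⟦ b ⟧b (evals-cong ts h) s
    satᶜ-cong (s ≐ t)     h p =
      ≡.trans (≡.sym (eval-cong s (h ∘ ∈-++⁺ˡ))) (≡.trans p (eval-cong t (h ∘ ∈-++⁺ʳ (fvᵗ s))))
    satᶜ-cong (c ∧ᶜ d)    h (p , q) = satᶜ-cong c (h ∘ ∈-++⁺ˡ) p , satᶜ-cong d (h ∘ ∈-++⁺ʳ (fvᶜ c)) q
    satᶜ-cong (∃ᶜ x c)    h (m , p) = m , satᶜ-cong c (update-agree (fvᶜ c) h) p

    ground-cong : ∀ {v w} a → AgreeOn (fvᵗˢ (args a)) v w → ground M v a ≡ ground M w a
    ground-cong (p · ts) h = cong (p ,_) (evals-cong ts h)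

    module _ (π : Var ↔ Var) where
      mutual
        eval-ren : ∀ {v} t → eval M v (renᵗ π t) ≡ eval M (v ∘ to π) t
        eval-ren (var x)   = ≡.refl
        eval-ren (fn f ts) = cong ⟦ f ⟧f (evals-ren ts)

        evals-ren : ∀ {v k} (ts : Vec Term k) → evals M v (renᵗˢ π ts) ≡ evals M (v ∘ to π) ts
        evals-ren []       = ≡.refl
        evals-ren (t ∷ ts) = cong₂ _∷_ (eval-ren t) (evals-ren ts)

      ground-ren : ∀ {v} a → ground M v (renᵘ π a) ≡ ground M (v ∘ to π) a
      ground-ren (p · ts) = cong (p ,_) (evals-ren ts)

      update-ren : ∀ (v : Valuation M) x m y →
        _[_↦_] M v (to π x) m (to π y) ≡ _[_↦_] M (v ∘ to π) x m y
      update-ren v x m y with to π y ≟ to π x | y ≟ x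
      ... | yes _  | yes _      = ≡.refl
      ... | no  _  | no  _      = ≡.refl
      ... | yes eq | no y≢x     = contradiction (to-injective π eq) y≢x
      ... | no neq | yes ≡.refl = contradiction ≡.refl neq

      sat-ren : ∀ {v} c → satᶜ M v (renᶜ π c) ⇔ satᶜ M (v ∘ to π) c
      sat-ren c = mk⇔ (fwd c) (bwd c)
        where
        fwd : ∀ {v} c → satᶜ M v (renᶜ π c) → satᶜ M (v ∘ to π) c
        fwd true        s = tt
        fwd (atom b ts) s = subst ⟦ b ⟧b (evals-ren ts) s
        fwd (s ≐ t)     p = ≡.trans (≡.sym (eval-ren s)) (≡.trans p (eval-ren t))
        fwd (c ∧ᶜ d)    (p , q) = fwd c p , fwd d q
        fwd (∃ᶜ x c)    (m , p) = m , satᶜ-cong c (λ _ → update-ren _ x m _) (fwd c p)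

        bwd : ∀ {v} c → satᶜ M (v ∘ to π) c → satᶜ M v (renᶜ π c)
        bwd true        s = tt
        bwd (atom b ts) s = subst ⟦ b ⟧b (≡.sym (evals-ren ts)) s
        bwd (s ≐ t)     p = ≡.trans (eval-ren s) (≡.trans p (≡.sym (eval-ren t)))
        bwd (c ∧ᶜ d)    (p , q) = bwd c p , bwd d q
        bwd (∃ᶜ x c)    (m , p) = m , bwd c (satᶜ-cong c (λ _ → ≡.sym (update-ren _ x m _)) p)

    ∃ᶜ*-elim : ∀ {v} xs c → satᶜ M v (∃ᶜ* xs c) → ∃ λ u → (∀ {x} → x ∉ xs → u x ≡ v x) × satᶜ M u c
    ∃ᶜ*-elim []       c s = _ , (λ _ → ≡.refl) , s
    ∃ᶜ*-elim {v} (x ∷ xs) c (m , s) with ∃ᶜ*-elim xs c s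
    ... | u , off , t = u , off′ , t
      where
      off′ : ∀ {y} → y ∉ x ∷ xs → u y ≡ v y
      off′ {y} y∉ with y ≟ x | off {y} (y∉ ∘ there)
      ... | yes eq | _ = contradiction (here eq) y∉
      ... | no  _  | e = e

    ∃ᶜ*-intro : ∀ {v u} xs c → (∀ {x} → x ∉ xs → u x ≡ v x) → satᶜ M u c → satᶜ M v (∃ᶜ* xs c)
    ∃ᶜ*-intro         []       c off s = satᶜ-cong c (λ _ → off (λ ())) s
    ∃ᶜ*-intro {v} {u} (x ∷ xs) c off s = u x , ∃ᶜ*-intro xs c off′ s
      where
      off′ : ∀ {y} → y ∉ xs → u y ≡ _[_↦_] M v x (u x) y
      off′ {y} y∉ with y ≟ x
      ... | yes ≡.refl = ≡.refl
      ... | no  y≢x    = off λ { (here eq) → y≢x eq ; (there y∈) → y∉ y∈ }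

    sat-eqs : ∀ {v k} (ss ts : Vec Term k) → satᶜ M v (eqs ss ts) ⇔ (evals M v ss ≡ evals M v ts)
    sat-eqs ss ts = mk⇔ (fwd ss ts) (bwd ss ts)
      where
      fwd : ∀ {v k} (ss ts : Vec Term k) → satᶜ M v (eqs ss ts) → evals M v ss ≡ evals M v ts
      fwd []       []       _       = ≡.refl
      fwd (s ∷ ss) (t ∷ ts) (p , q) = cong₂ _∷_ p (fwd ss ts q)

      bwd : ∀ {v k} (ss ts : Vec Term k) → evals M v ss ≡ evals M v ts → satᶜ M v (eqs ss ts)
      bwd []       []       _ = tt
      bwd (s ∷ ss) (t ∷ ts) e with ∷-injective e
      ... | p , q = p , bwd ss ts q

    sat-conj : ∀ {v} cs → satᶜ M v (conj cs) ⇔ All (satᶜ M v) cs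
    sat-conj cs = mk⇔ (fwd cs) (bwd cs)
      where
      fwd : ∀ {v} cs → satᶜ M v (conj cs) → All (satᶜ M v) cs
      fwd []       _       = []
      fwd (c ∷ cs) (p , q) = p ∷ fwd cs q

      bwd : ∀ {v} cs → All (satᶜ M v) cs → satᶜ M v (conj cs)
      bwd []       []       = tt
      bwd (c ∷ cs) (p ∷ ps) = p , bwd cs ps

  -- Running a derivation, renamed, inside a larger configuration

  -- User atoms contain no binders and are related literally. For built-ins, satisfaction and an
  -- upper bound on the free variables are what a replayed `solve` and the freshness conditions
  -- require.
  data Renamed (π : Var ↔ Var) : Item → Item → Set₁ where
    builtin : ∀ {c c′} →
      (∀ M {v} → satᶜ M v c′ ⇔ satᶜ M (v ∘ to π) c) →
      fvᶜ c′ ⊆ map (to π) (fvᶜ c) →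
      Renamed π (builtin c) (builtin c′)
    user : ∀ {a b} → b ≡ renᵘ π a → Renamed π (user a) (user b)

  renⁱ-Renamed : ∀ π i → Renamed π i (renⁱ π i)
  renⁱ-Renamed π (builtin c) =
    builtin (λ M → sat-ren M π c) (λ {z} → subst (z ∈_) (fv-renᶜ π c))
  renⁱ-Renamed π (user a)    = user ≡.refl

  -- This relation, unlike renⁱ, leaves alone an item none of whose free variables
  -- moves: renⁱ would still rename its bound variables.
  fixed-Renamed : ∀ π i → AgreeOn (fvⁱ i) (to π) id → Renamed π i i
  fixed-Renamed π (builtin c) fix = builtin
    (λ M {v} → mk⇔ (satᶜ-cong M c (λ x∈ → cong v (≡.sym (fix x∈))))
                   (satᶜ-cong M c (λ x∈ → cong v (fix x∈))))
    (λ x∈ → subst (_∈ map (to π) (fvᶜ c)) (fix x∈) (∈-map⁺ (to π) x∈))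
  fixed-Renamed π (user (p · ts)) fix = user (cong (p ·_) (≡.sym (ren-fixᵗˢ π ts fix)))

  renⁱ-Renamed* : ∀ π G → Pointwise (Renamed π) G (map (renⁱ π) G)
  renⁱ-Renamed* π []      = []
  renⁱ-Renamed* π (i ∷ G) = renⁱ-Renamed π i ∷ renⁱ-Renamed* π G

  fixed-Renamed* : ∀ π G → AgreeOn (fvᵍ G) (to π) id → Pointwise (Renamed π) G G
  fixed-Renamed* π []      fix = []
  fixed-Renamed* π (i ∷ G) fix =
    fixed-Renamed π i (fix ∘ ∈-++⁺ˡ) ∷ fixed-Renamed* π G (fix ∘ ∈-++⁺ʳ (fvⁱ i))

  fv-Renamed : ∀ {π i j} → Renamed π i j → fvⁱ j ⊆ map (to π) (fvⁱ i)
  fv-Renamed         (builtin _ fv⊆)                  z∈ = fv⊆ z∈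
  fv-Renamed {π = π} (user {a = p · ts} ≡.refl) {z}   z∈ = subst (z ∈_) (fv-renᵗˢ π ts) z∈

  map-++⁺ : ∀ π xs {ys z} → z ∈ map (to π) xs ⊎ z ∈ map (to π) ys → z ∈ map (to π) (xs ++ ys)
  map-++⁺ π xs {z = z} z∈ =
    subst (z ∈_) (≡.sym (map-++ (to π) xs _)) ([ ∈-++⁺ˡ , ∈-++⁺ʳ (map (to π) xs) ]′ z∈)

  fv-Renamed* : ∀ {π G G′} → Pointwise (Renamed π) G G′ → fvᵍ G′ ⊆ map (to π) (fvᵍ G)
  fv-Renamed* {π} (_∷_ {x = i} {y = j} r rs) z∈ with ∈-++⁻ (fvⁱ j) z∈
  ... | inj₁ z∈j = map-++⁺ π (fvⁱ i) (inj₁ (fv-Renamed r z∈j))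
  ... | inj₂ z∈G = map-++⁺ π (fvⁱ i) (inj₂ (fv-Renamed* rs z∈G))

  -- c* is c renamed by π, next to the further constraints G, K and d.
  record Embeds (π : Var ↔ Var) (G : Goal) (K : List UAtom) (d : Constraint) (c c* : Config) : Set₁ where
    field
      {items}       : Goal
      items-renamed : Pointwise (Renamed π) (Config.goal c) items
      goal↭         : Config.goal c* ↭ items ++ G
      store↭        : Config.store c* ↭ map (renᵘ π) (Config.store c) ++ K
      built⇔        : ∀ M → Model CT M → ∀ {v} →
        satᶜ M v (Config.built c*) ⇔ (satᶜ M (v ∘ to π) (Config.built c) × satᶜ M v d)
      -- Equivalence under `CT` does not control free variables. `built⊆` keeps replayed rule
      -- variants fresh; `built⊇` lets freshness for `c*` imply freshness for its constituents.
      built⊆        : fvᶜ (Config.built c*) ⊆ map (to π) (fvᶜ (Config.built c)) ++ fvᶜ d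
      built⊇        : map (to π) (fvᶜ (Config.built c)) ++ fvᶜ d ⊆ fvᶜ (Config.built c*)
  open Embeds

  -- Gathered over a whole run by `runVars`, so that one renaming can be chosen before the replay
  -- starts.
  stepVars : ∀ {P V c c′} → Step P V c c′ → List Var
  stepVars (solve _ _)                                      = []
  stepVars (introduce _)                                    = []
  stepVars (simplify  {H = H} {C = C} {B = B} _ _ _ _) = fvʳ (rule simplification H C B)
  stepVars (propagate {H = H} {C = C} {B = B} _ _ _ _) = fvʳ (rule propagation H C B)

  ∈-map-ren⁻ : ∀ π {xs y} → to π y ∈ map (to π) xs → y ∈ xs
  ∈-map-ren⁻ π {xs} πy∈ with ∈-map⁻ (to π) πy∈
  ... | x , x∈ , eq = subst (_∈ xs) (≡.sym (to-injective π eq)) x∈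

  module _ {π : Var ↔ Var} {Gᵒ : Goal} {Kᵒ : List UAtom} {dᵒ : Constraint} where

    -- A variable `y` of the variant is outside `V`, so `apart` keeps its image clear of `V′` and of
    -- the surroundings. A clash with the renamed part would, `to π` being injective, put `y` itself
    -- into `c`, for which the variant was fresh.
    embeds-fresh : ∀ {P V V′ c c* r} → Embeds π Gᵒ Kᵒ dᵒ c c* →
      (∀ {y} → y ∈ fvʳ r → y ∉ V → to π y ∉ V′ ++ fvᵍ Gᵒ ++ fvᵘ Kᵒ ++ fvᶜ dᵒ) →
      FreshVariant P V c r → FreshVariant P V′ c* (renʳ π r)
    embeds-fresh {V = V} {V′} {⟨ G , K , d ⟩} {⟨ G* , K* , d* ⟩} {r} emb apart (r₀ , ρ , r₀∈ , r≡ , disjoint) =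
      r₀ , π ↔-∘ ρ , r₀∈ , ≡.trans (cong (renʳ π) r≡) (ren-∘ʳ ρ π r₀) , disjoint′
      where
      disjoint′ : Disjoint (fvʳ (renʳ π r)) (V′ ++ fvᵍ G* ++ fvᵘ K* ++ fvᶜ d*)
      disjoint′ {z} (z∈r , z∈c) with ∈-map⁻ (to π) (subst (z ∈_) (fv-renʳ π r) z∈r)
      ... | y , y∈r , ≡.refl = go z∈c
        where
        y∉V : y ∉ V
        y∉V y∈V = disjoint (y∈r , ∈-++⁺ˡ y∈V)
        y∉c : y ∉ fvᵍ G ++ fvᵘ K ++ fvᶜ d
        y∉c y∈c = disjoint (y∈r , ∈-++⁺ʳ V y∈c)
        out : to π y ∉ V′ ++ fvᵍ Gᵒ ++ fvᵘ Kᵒ ++ fvᶜ dᵒ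
        out = apart y∈r y∉V
        go : to π y ∉ V′ ++ fvᵍ G* ++ fvᵘ K* ++ fvᶜ d*
        go z∈ with ∈-++⁻ V′ z∈
        ... | inj₁ z∈V′ = out (∈-++⁺ˡ z∈V′)
        ... | inj₂ z∈₁ with ∈-++⁻ (fvᵍ G*) z∈₁
        ...   | inj₁ z∈G* with ∈-++⁻ (fvᵍ (items emb)) (concatMap-++⁻ fvⁱ (items emb) (concatMap-⊆ fvⁱ (goal↭ emb) z∈G*))
        ...     | inj₁ z∈items = y∉c (∈-++⁺ˡ (∈-map-ren⁻ π (fv-Renamed* (items-renamed emb) z∈items)))
        ...     | inj₂ z∈Gᵒ    = out (∈-++⁺ʳ V′ (∈-++⁺ˡ z∈Gᵒ))
        go z∈ | inj₂ z∈₁ | inj₂ z∈₂ with ∈-++⁻ (fvᵘ K*) z∈₂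
        ...   | inj₁ z∈K* with ∈-++⁻ (fvᵘ (map (renᵘ π) K))
                                 (concatMap-++⁻ _ (map (renᵘ π) K) (concatMap-⊆ _ (store↭ emb) z∈K*))
        ...     | inj₁ z∈K  = y∉c (∈-++⁺ʳ (fvᵍ G) (∈-++⁺ˡ (∈-map-ren⁻ π (subst (to π y ∈_) (fv-renᵘ π K) z∈K))))
        ...     | inj₂ z∈Kᵒ = out (∈-++⁺ʳ V′ (∈-++⁺ʳ (fvᵍ Gᵒ) (∈-++⁺ˡ z∈Kᵒ)))
        go z∈ | inj₂ z∈₁ | inj₂ z∈₂ | inj₂ z∈d* with ∈-++⁻ (map (to π) (fvᶜ d)) (built⊆ emb z∈d*)
        ...   | inj₁ z∈d  = y∉c (∈-++⁺ʳ (fvᵍ G) (∈-++⁺ʳ (fvᵘ K) (∈-map-ren⁻ π z∈d)))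
        ...   | inj₂ z∈dᵒ = out (∈-++⁺ʳ V′ (∈-++⁺ʳ (fvᵍ Gᵒ) (∈-++⁺ʳ (fvᵘ Kᵒ) z∈dᵒ)))

    -- Entailment survives strengthening of the constraint: a solution of the larger one, read
    -- through `π`, solves the original one.
    embeds-applicable : ∀ {c c* H C e} → Embeds π Gᵒ Kᵒ dᵒ c c* → Applicable H C e (Config.built c) →
      Applicable (List⁺.map (renᵘ π) H) (map (renᶜ π) C) (renᶜ π e) (Config.built c*)
    embeds-applicable {H = H} {C} {e} emb app M model v s =
      subst (satᶜ M v) ren-closure
        (Equivalence.from (sat-ren M π (∃ᶜ* (fvᵘ (toList H)) (e ∧ᶜ conj C)))
          (app M model (v ∘ to π) (proj₁ (Equivalence.to (built⇔ emb M model) s))))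
      where
      ren-closure : renᶜ π (∃ᶜ* (fvᵘ (toList H)) (e ∧ᶜ conj C)) ≡
                    ∃ᶜ* (fvᵘ (map (renᵘ π) (toList H))) (renᶜ π e ∧ᶜ conj (map (renᶜ π) C))
      ren-closure = ≡.trans (ren-∃ᶜ* π (fvᵘ (toList H)) _)
        (cong₂ ∃ᶜ* (≡.sym (fv-renᵘ π (toList H))) (cong (renᶜ π e ∧ᶜ_) (ren-conj π C)))

    embeds-split : ∀ {K K* H′ K′} → K* ↭ map (renᵘ π) K ++ Kᵒ → K ↭ H′ ++ K′ →
      K* ↭ map (renᵘ π) H′ ++ (map (renᵘ π) K′ ++ Kᵒ)
    embeds-split {H′ = H′} p q = ↭-trans p (↭-trans (↭ₚ.++⁺ʳ Kᵒ (↭ₚ.map⁺ (renᵘ π) q))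
      (↭-reflexive (≡.trans (cong (_++ Kᵒ) (map-++ (renᵘ π) H′ _)) (++-assoc (map (renᵘ π) H′) _ _))))

    embeds-rule : ∀ {G G* K K* d d* K′ K*′} B e → Embeds π Gᵒ Kᵒ dᵒ ⟨ G , K , d ⟩ ⟨ G* , K* , d* ⟩ →
      K*′ ↭ map (renᵘ π) K′ ++ Kᵒ →
      Embeds π Gᵒ Kᵒ dᵒ ⟨ B ++ G , K′ , e ∧ᶜ d ⟩ ⟨ map (renⁱ π) B ++ G* , K*′ , renᶜ π e ∧ᶜ d* ⟩
    embeds-rule {d = d} {d*} B e emb q = record
      { items-renamed = Pointwise.++⁺ (renⁱ-Renamed* π B) (items-renamed emb)
      ; goal↭  = ↭-trans (↭ₚ.++⁺ˡ (map (renⁱ π) B) (goal↭ emb))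
                         (↭-reflexive (≡.sym (++-assoc (map (renⁱ π) B) _ _)))
      ; store↭ = q
      ; built⇔ = λ M model → let module E = Equivalence (sat-ren M π e)
                                 module D = Equivalence (built⇔ emb M model) in
          mk⇔ (λ { (s , t) → (E.to s , proj₁ (D.to t)) , proj₂ (D.to t) })
              (λ { ((s , t) , o) → E.from s , D.from (t , o) })
      ; built⊆ = ⊆′
      ; built⊇ = ⊇′
      }
      where
      ⊆′ : fvᶜ (renᶜ π e ∧ᶜ d*) ⊆ map (to π) (fvᶜ e ++ fvᶜ d) ++ fvᶜ dᵒ
      ⊆′ {z} z∈ with ∈-++⁻ (fvᶜ (renᶜ π e)) z∈
      ... | inj₁ z∈e = ∈-++⁺ˡ (map-++⁺ π (fvᶜ e) (inj₁ (subst (z ∈_) (fv-renᶜ π e) z∈e)))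
      ... | inj₂ z∈d* with ∈-++⁻ (map (to π) (fvᶜ d)) (built⊆ emb z∈d*)
      ...   | inj₁ z∈d = ∈-++⁺ˡ (map-++⁺ π (fvᶜ e) (inj₂ z∈d))
      ...   | inj₂ z∈o = ∈-++⁺ʳ (map (to π) (fvᶜ e ++ fvᶜ d)) z∈o
      ⊇′ : map (to π) (fvᶜ e ++ fvᶜ d) ++ fvᶜ dᵒ ⊆ fvᶜ (renᶜ π e ∧ᶜ d*)
      ⊇′ {z} z∈ with ∈-++⁻ (map (to π) (fvᶜ e ++ fvᶜ d)) z∈
      ... | inj₂ z∈o = ∈-++⁺ʳ (fvᶜ (renᶜ π e)) (built⊇ emb (∈-++⁺ʳ (map (to π) (fvᶜ d)) z∈o))
      ... | inj₁ z∈ed with ∈-++⁻ (map (to π) (fvᶜ e)) (subst (z ∈_) (map-++ (to π) (fvᶜ e) _) z∈ed)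
      ...   | inj₁ z∈e = ∈-++⁺ˡ (subst (z ∈_) (≡.sym (fv-renᶜ π e)) z∈e)
      ...   | inj₂ z∈d = ∈-++⁺ʳ (fvᶜ (renᶜ π e)) (built⊇ emb (∈-++⁺ˡ z∈d))

    embeds-step : ∀ {P V V′ c c′ c*} (s : Step P V c c′) → Embeds π Gᵒ Kᵒ dᵒ c c* →
      (∀ {y} → y ∈ stepVars s → y ∉ V → to π y ∉ V′ ++ fvᵍ Gᵒ ++ fvᵘ Kᵒ ++ fvᶜ dᵒ) →
      ∃ λ c*′ → Step P V′ c* c*′ × Embeds π Gᵒ Kᵒ dᵒ c′ c*′
    embeds-step {c* = ⟨ G* , K* , d* ⟩} (solve {d′ = d′} G↭ c∧d⇔d′) emb apart
      with Pointwise-↭ G↭ (items-renamed emb)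
    ... | _ , items↭ , builtin {c} {c′} c′⇔c fv⊆ ∷ rest =
      -- `solve` determines the new constraint up to equivalence only; this choice has exactly the
      -- free variables demanded by `built⊆` and `built⊇`.
      ⟨ _ , K* , renᶜ π d′ ∧ᶜ dᵒ ⟩ ,
      solve (↭-trans (goal↭ emb) (↭ₚ.++⁺ʳ Gᵒ items↭)) equiv ,
      record
        { items-renamed = rest
        ; goal↭  = refl
        ; store↭ = store↭ emb
        ; built⇔ = λ M model → let module D = Equivalence (sat-ren M π d′) in
            mk⇔ (λ { (s , o) → D.to s , o }) (λ { (s , o) → D.from s , o })
        ; built⊆ = λ {z} → subst (λ xs → z ∈ xs ++ fvᶜ dᵒ) (fv-renᶜ π d′)
        ; built⊇ = λ {z} → subst (λ xs → z ∈ xs ++ fvᶜ dᵒ) (≡.sym (fv-renᶜ π d′))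
        }
      where
      equiv : CT ⊨ ⌈ c′ ∧ᶜ d* ⌉ ⇔ᶠ ⌈ renᶜ π d′ ∧ᶜ dᵒ ⌉
      equiv M model v =
        (λ { (s , t) → let t₁ , o = D.to t in
                       R.from (proj₁ (c∧d⇔d′ M model (v ∘ to π)) (C.to s , t₁)) , o }) ,
        (λ { (s , o) → let s₁ , t₁ = proj₂ (c∧d⇔d′ M model (v ∘ to π)) (R.to s) in
                       C.from s₁ , D.from (t₁ , o) })
        where
        module C = Equivalence (c′⇔c M {v})
        module D = Equivalence (built⇔ emb M model {v})
        module R = Equivalence (sat-ren M π {v} d′)
    embeds-step {c* = ⟨ G* , K* , d* ⟩} (introduce G↭) emb apart
      with Pointwise-↭ G↭ (items-renamed emb)
    ... | _ , items↭ , user {a} ≡.refl ∷ rest =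
      ⟨ _ , renᵘ π a ∷ K* , d* ⟩ ,
      introduce (↭-trans (goal↭ emb) (↭ₚ.++⁺ʳ Gᵒ items↭)) ,
      record
        { items-renamed = rest
        ; goal↭  = refl
        ; store↭ = prep _ (store↭ emb)
        ; built⇔ = built⇔ emb
        ; built⊆ = built⊆ emb
        ; built⊇ = built⊇ emb
        }
    embeds-step {V′ = V′} (simplify {H′ = H′} {K′} {e = e} {H} {C} {B} K↭ fresh E app) emb apart =
      _ ,
      simplify (embeds-split {H′ = H′} {K′} (store↭ emb) K↭) (embeds-fresh {V′ = V′} emb apart fresh) (ren-Equate π E)
               (embeds-applicable {H = H} {C} {e} emb app) ,
      embeds-rule B e emb refl
    embeds-step {V′ = V′} (propagate {H′ = H′} {K′} {e = e} {H} {C} {B} K↭ fresh E app) emb apart =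
      _ ,
      propagate (embeds-split {H′ = H′} {K′} (store↭ emb) K↭) (embeds-fresh {V′ = V′} emb apart fresh) (ren-Equate π E)
                (embeds-applicable {H = H} {C} {e} emb app) ,
      embeds-rule B e emb (↭-reflexive (≡.trans (≡.sym (++-assoc (map (renᵘ π) H′) _ _))
                                                (cong (_++ Kᵒ) (≡.sym (map-++ (renᵘ π) H′ _)))))

  runVars : ∀ {P V c c′} → Star (Step P V) c c′ → List Var
  runVars ε        = []
  runVars (s ◅ ss) = stepVars s ++ runVars ss

  embeds-run : ∀ {π G K d P V V′ c c′ c*} (run : Star (Step P V) c c′) → Embeds π G K d c c* →
    (∀ {y} → y ∈ runVars run → y ∉ V → to π y ∉ V′ ++ fvᵍ G ++ fvᵘ K ++ fvᶜ d) →
    ∃ λ c*′ → Star (Step P V′) c* c*′ × Embeds π G K d c′ c*′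
  embeds-run ε        emb apart = _ , ε , emb
  embeds-run (s ◅ ss) emb apart with embeds-step s emb (apart ∘ ∈-++⁺ˡ)
  ... | _ , s* , emb₁ with embeds-run ss emb₁ (apart ∘ ∈-++⁺ʳ (stepVars s))
  ...   | _ , ss* , emb₂ = _ , s* ◅ ss* , emb₂

  -- Putting answers that consist of copies of one atom together

  override : {A : Set} → List Var → (v w : Var → A) → Var → A
  override xs v w x with x ∈? xs
  ... | yes _ = w x
  ... | no  _ = v x

  override-∈ : ∀ {A : Set} xs {v w : Var → A} {x} → x ∈ xs → override xs v w x ≡ w x
  override-∈ xs {x = x} x∈ with x ∈? xs
  ... | yes _  = ≡.refl
  ... | no  x∉ = contradiction x∈ x∉

  override-∉ : ∀ {A : Set} xs {v w : Var → A} {x} → x ∉ xs → override xs v w x ≡ v x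
  override-∉ xs {x = x} x∉ with x ∈? xs
  ... | yes x∈ = contradiction x∈ x∉
  ... | no  _  = ≡.refl

  copies : UAtom → ℕ → Goal
  copies a k = map user (replicate k a)

  copiesAnswer : UAtom → ℕ → Answer
  copiesAnswer a k = ∃-[ fvᵍ (copies a k) ] replicate k a ∧ true

  -- What copiesAnswer a (suc j) ≃ (∃-[ V ] K ∧ d) means for V, K and d.
  module CopiesOf (a : UAtom) (j : ℕ) {V : List Var} {K : List UAtom} {d : Constraint}
                  (eq : copiesAnswer a (suc j) ≃ (∃-[ V ] K ∧ d)) (M : Structure) (model : Model CT M) where

    private
      ground-copies : ∀ v k → map (ground M v) (replicate k a) ≡ replicate k (ground M v a)
      ground-copies v k = map-replicate (ground M v) k a

      denotes : ∀ v → Denotes M v (∃-[ V ] K ∧ d) (replicate (suc j) (ground M v a))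
      denotes v = Equivalence.to (eq M model v _)
        (v , (λ _ _ → ≡.refl) , tt , ↭-reflexive (ground-copies v (suc j)))

      denotes⁻ : ∀ {v gs} → Denotes M v (∃-[ V ] K ∧ d) gs → gs ↭ replicate (suc j) (ground M v a)
      denotes⁻ {v} D with Equivalence.from (eq M model v _) D
      ... | θ , agree , _ , gs↭ = ↭-trans (↭-sym gs↭)
        (↭-reflexive (≡.trans (ground-copies θ (suc j))
          (cong (replicate (suc j)) (ground-cong M a (λ x∈ → agree _ (∈-++⁺ˡ x∈))))))

    -- Copies of `a` have an instance under every valuation, so `d` cannot restrict the variables of
    -- `V`.
    extension : ∀ v → ∃ λ θ → AgreeOn V θ v × satᶜ M θ d
    extension v with denotes v
    ... | θ , agree , s , _ = θ , agree _ , s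

    grounds↭ : ∀ {θ} → satᶜ M θ d → map (ground M θ) K ↭ replicate (suc j) (ground M θ a)
    grounds↭ {θ} s = denotes⁻ (θ , (λ _ _ → ≡.refl) , s , refl)

    grounds-≡ : ∀ {θ} → satᶜ M θ d → All (λ b → ground M θ b ≡ ground M θ a) K
    grounds-≡ {θ} s = Allₚ.map⁻ {P = _≡ ground M θ a} (↭ₚ.All-resp-↭ (↭-sym (grounds↭ s)) (Allₚ.replicate⁺ (suc j) ≡.refl))

    -- a need not contain only variables of V, but its value depends on these only.
    ground-local : ∀ {v w} → AgreeOn V v w → ground M v a ≡ ground M w a
    ground-local {v} {w} v≡w with denotes v
    ... | θ , agree , s , gs↭
      -- The witness is compared with `v` on `V` only, so it serves `w` as well; the first of the
      -- `suc j` copies then carries both values.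
      with denotes⁻ (θ , (λ x x∈ → ≡.trans (agree x x∈) (v≡w x∈)) , s , gs↭)
    ...   | p with ↭ₚ.All-resp-↭ (↭-sym p) (Allₚ.replicate⁺ {P = _≡ ground M w a} (suc j) ≡.refl)
    ...     | v≡w ∷ _ = v≡w

    private
      θ₀ : ∃ λ θ → satᶜ M θ d
      θ₀ = _ , proj₂ (proj₂ (extension (λ _ → Structure.point M)))

    -- Symbols and length are syntactic, so one model is enough to read them off; its `point`
    -- supplies a valuation from which a solution of `d` is obtained.
    symbols-≡ : All (λ b → sym b ≡ sym a) K
    symbols-≡ = All.map (cong proj₁) (grounds-≡ (proj₂ θ₀))

    length-copies : length K ≡ suc j
    length-copies = ≡.trans (≡.sym (length-map (ground M (proj₁ θ₀)) K))
      (≡.trans (↭ₚ.↭-length (grounds↭ (proj₂ θ₀))) (length-replicate (suc j)))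

  Pointwise-const : ∀ {A B : Set} {f : A → B} {y} {xs xs′} → length xs ≡ length xs′ →
    All (λ x → f x ≡ y) xs → All (λ x → f x ≡ y) xs′ → Pointwise (λ x x′ → f x ≡ f x′) xs xs′
  Pointwise-const _  []       []         = []
  Pointwise-const eq (p ∷ ps) (p′ ∷ ps′) =
    ≡.trans p (≡.sym p′) ∷ Pointwise-const (suc-injective eq) ps ps′

  -- Whether a match is defined depends on the symbols alone, so a head that fits `H′` fits `H″`;
  -- the new equations hold wherever corresponding atoms have equal values.
  Equate-replace : ∀ {H H′ e H″} → Equate H H′ e → Pointwise (λ b c → sym b ≡ sym c) H′ H″ →
    ∃ λ e′ → Equate H H″ e′ ×
      (∀ M {u} → Pointwise (λ b c → ground M u b ≡ ground M u c) H′ H″ → satᶜ M u e → satᶜ M u e′)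
  Equate-replace nil [] = true , nil , λ _ _ _ → tt
  Equate-replace (cons {ss = ss} {ts} E) (_∷_ {y = _ · ts′} ≡.refl eqs′) with Equate-replace E eqs′
  ... | _ , E′ , sat-E′ = _ , cons E′ , λ where
    M {u} (ts≡ ∷ rest) (s , t) →
      Equivalence.from (sat-eqs M ss ts′)
        (≡.trans (Equivalence.to (sat-eqs M ss ts) s) (,-injectiveʳ-UIP ≡-irrelevant ts≡)) ,
      sat-E′ M rest t

  -- Head variables are bound in the closure but may be listed with those of the guard: both are
  -- fresh rule variables and are treated alike in `exchange-applicable`.
  fv-closure : ∀ {H H′ C e z} → Equate H H′ e → z ∈ fvᶜ (∃ᶜ* (fvᵘ H) (e ∧ᶜ conj C)) →
    z ∈ fvᵘ H′ ⊎ z ∈ fvᵘ H ++ concatMap fvᶜ C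
  fv-closure {H} {C = C} {e} {z} E z∈ with ∈-++⁻ (fvᶜ e) (fv-∃ᶜ* (fvᵘ H) z∈)
  ... | inj₂ z∈C = inj₂ (∈-++⁺ʳ (fvᵘ H) (subst (z ∈_) (fv-conj C) z∈C))
  ... | inj₁ z∈e with ∈-++⁻ (fvᵘ H) (fv-Equate E z∈e)
  ...   | inj₁ z∈H  = inj₂ (∈-++⁺ˡ z∈H)
  ...   | inj₂ z∈H′ = inj₁ z∈H′

  -- Finality of the combined configuration

  module _ {a : UAtom} {j i : ℕ} {π : Var ↔ Var} {V₁ V₂ V* : List Var}
           {K₁ K₂ K* : List UAtom} {d₁ d₂ d* : Constraint}
           (eq₁ : copiesAnswer a (suc j) ≃ (∃-[ V₁ ] K₁ ∧ d₁))
           (eq₂ : copiesAnswer a (suc i) ≃ (∃-[ V₂ ] K₂ ∧ d₂))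
           (V₁⊆V* : V₁ ⊆ V*)
           (π-fixes : AgreeOn V₂ (to π) id)
           (π-apart : ∀ {x} → x ∈ fvᶜ d₂ → x ∉ V₂ → to π x ∉ fvᵘ K₁ ++ fvᶜ d₁)
           (emb : Embeds π [] K₁ d₁ ⟨ [] , K₂ , d₂ ⟩ ⟨ [] , K* , d* ⟩)
           where

    private
      fv₂ : List Var
      fv₂ = map (to π) (fvᶜ d₂)

      fv-K₁⊆K* : fvᵘ K₁ ⊆ fvᵘ K*
      fv-K₁⊆K* z∈ = concatMap-⊆ _ (↭-sym (store↭ emb)) (concatMap-++⁺ʳ _ (map (renᵘ π) K₂) z∈)

      fv-d₁⊆d* : fvᶜ d₁ ⊆ fvᶜ d*
      fv-d₁⊆d* z∈ = built⊇ emb (∈-++⁺ʳ fv₂ z∈)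

    -- d₂ is satisfiable whatever the values of the variables of V₂ are, so a valuation
    -- satisfying d₁ can be made to satisfy d* by changing variables local to d₂ only.
    extend-valuation : ∀ M → Model CT M → ∀ v → satᶜ M v d₁ → ∃ λ v′ →
      satᶜ M v′ d* ×
      AgreeOn (fvᵘ K₁ ++ fvᶜ d₁) v′ v ×
      (∀ {z} → z ∉ fvᶜ d* → v′ z ≡ v z) ×
      All (λ b → ground M v′ b ≡ ground M v′ a) K*
    extend-valuation M model v sat-d₁ = v′ , sat-d* , agree , outside , grounds
      where
      module C₁ = CopiesOf a j {V₁} {K₁} {d₁} eq₁ M model
      module C₂ = CopiesOf a i {V₂} {K₂} {d₂} eq₂ M model

      θ : Valuation M
      θ = proj₁ (C₂.extension v)

      θ-agree : AgreeOn V₂ θ v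
      θ-agree = proj₁ (proj₂ (C₂.extension v))

      v′ : Valuation M
      -- In `d*` the constraint `d₂` occurs renamed, so its solution is transported by the inverse
      -- of `π`. On `V₂` this changes nothing: `π` fixes `V₂`, where `θ` agrees with `v`.
      v′ = override fv₂ v (θ ∘ Inverse.from π)

      v′-ren : ∀ {y} → y ∈ fvᶜ d₂ → v′ (to π y) ≡ θ y
      v′-ren y∈ = ≡.trans (override-∈ fv₂ (∈-map⁺ (to π) y∈)) (cong θ (Inverse.strictlyInverseʳ π _))

      agree : AgreeOn (fvᵘ K₁ ++ fvᶜ d₁) v′ v
      agree {z} z∈ with z ∈? fv₂
      ... | no  z∉ = ≡.refl
      ... | yes z∈fv₂ with ∈-map⁻ (to π) z∈fv₂
      ...   | y , y∈ , ≡.refl with y ∈? V₂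
      ...     | no  y∉V₂ = contradiction z∈ (π-apart y∈ y∉V₂)
      ...     | yes y∈V₂ = ≡.trans (cong θ (Inverse.strictlyInverseʳ π y))
                             (≡.trans (θ-agree y∈V₂) (cong v (≡.sym (π-fixes y∈V₂))))

      outside : ∀ {z} → z ∉ fvᶜ d* → v′ z ≡ v z
      outside z∉ = override-∉ fv₂ (λ z∈ → z∉ (built⊇ emb (∈-++⁺ˡ z∈)))

      sat-d₁′ : satᶜ M v′ d₁
      sat-d₁′ = satᶜ-cong M d₁ (λ z∈ → ≡.sym (agree (∈-++⁺ʳ (fvᵘ K₁) z∈))) sat-d₁

      sat-d₂ : satᶜ M (v′ ∘ to π) d₂
      sat-d₂ = satᶜ-cong M d₂ (λ y∈ → ≡.sym (v′-ren y∈)) (proj₂ (proj₂ (C₂.extension v)))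

      sat-d* : satᶜ M v′ d*
      sat-d* = Equivalence.from (built⇔ emb M model) (sat-d₂ , sat-d₁′)

      grounds : All (λ b → ground M v′ b ≡ ground M v′ a) K*
      grounds = ↭ₚ.All-resp-↭ (↭-sym (store↭ emb)) (Allₚ.++⁺
        (Allₚ.map⁺ (All.map
          (λ {b} p → ≡.trans (ground-ren M π b)
                       -- `a` may have variables that `π` moves, but its value depends only on `V₂`,
                       -- which `π` fixes.
                       (≡.trans p (C₂.ground-local (λ x∈ → cong v′ (π-fixes x∈)))))
          (C₂.grounds-≡ sat-d₂)))
        (C₁.grounds-≡ sat-d₁′))

    -- All atoms of K* have the same value under the valuations that matter, so the atoms
    -- H′ matched by a head may be exchanged for others.
    exchange-applicable : ∀ {k H C B H′ H″ e e′} →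
      Disjoint (fvʳ (rule k H C B)) (V* ++ fvᶜᶠᵍ ⟨ [] , K* , d* ⟩) →
      (∀ {P : Pred UAtom 0ℓ} → All P K* → All P H′ × All P H″) → fvᵘ H″ ⊆ fvᵘ K₁ →
      length H′ ≡ length H″ → Equate (toList H) H″ e′ →
      (∀ M {u} → Pointwise (λ b c → ground M u b ≡ ground M u c) H′ H″ → satᶜ M u e → satᶜ M u e′) →
      Applicable H C e d* → Applicable H C e′ d₁
    exchange-applicable {k} {H} {C} {B} {H′} {H″} {e} {e′} disjoint prefix H″⊆ same-length E′ sat-e′ app
      M model v sat-d₁ with extend-valuation M model v sat-d₁
    ... | v′ , sat-d* , agree , outside , grounds =
      -- The way back from `v′` to `v`: variables of `H″` occur in `K₁`, where both agree, and rule
      -- variables do not occur in `d*`, outside of which both agree too.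
      satᶜ-cong M (∃ᶜ* xs (e′ ∧ᶜ conj C))
        (λ z∈ → [ agree ∘ ∈-++⁺ˡ ∘ H″⊆ , outside ∘ d*-fresh ]′ (fv-closure {C = C} E′ z∈))
        sat-closure
      where
      xs : List Var
      xs = fvᵘ (toList H)

      K*-fresh : ∀ {z} → z ∈ fvᵘ K* → z ∉ xs
      K*-fresh z∈K* z∈H = disjoint (∈-++⁺ˡ z∈H , ∈-++⁺ʳ V* (∈-++⁺ˡ z∈K*))

      d*-fresh : ∀ {z} → z ∈ xs ++ concatMap fvᶜ C → z ∉ fvᶜ d*
      d*-fresh z∈ z∈d* = disjoint
        ([ ∈-++⁺ˡ , (λ z∈C → ∈-++⁺ʳ xs (∈-++⁺ˡ z∈C)) ]′ (∈-++⁻ xs z∈) ,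
         ∈-++⁺ʳ V* (∈-++⁺ʳ (fvᵘ K*) z∈d*))

      sat-closure : satᶜ M v′ (∃ᶜ* xs (e′ ∧ᶜ conj C))
      sat-closure with ∃ᶜ*-elim M xs (e ∧ᶜ conj C) (app M model v′ sat-d*)
      -- `u` departs from `v′` on head variables only. These do not occur in `K*`, so all atoms of
      -- the store keep their common value.
      ... | u , off , sat-e , sat-C = ∃ᶜ*-intro M xs (e′ ∧ᶜ conj C) off
        (sat-e′ M (Pointwise-const same-length (proj₁ u-grounds) (proj₂ u-grounds)) sat-e , sat-C)
        where
        fresh-atoms : ∀ K → fvᵘ K ⊆ fvᵘ K* → All (λ b → ground M u b ≡ ground M v′ b) K
        fresh-atoms []      _  = []
        fresh-atoms (b ∷ K) K⊆ =
          ground-cong M b (λ x∈ → off (K*-fresh (K⊆ (∈-++⁺ˡ x∈)))) ∷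
          fresh-atoms K (K⊆ ∘ ∈-++⁺ʳ (fvᵗˢ (args b)))

        u-grounds : All (λ b → ground M u b ≡ ground M v′ a) H′ × All (λ b → ground M u b ≡ ground M v′ a) H″
        -- `prefix` is the form in which `H′` and `H″` are known to be drawn from `K*`.
        u-grounds = prefix (All.zipWith (λ { (p , q) → ≡.trans p q }) (fresh-atoms K* id , grounds))

    Match : List⁺ UAtom → List Constraint → Set₁
    Match H C = ∃₂ λ H′ K′ → ∃ λ e → K₁ ↭ H′ ++ K′ × Equate (toList H) H′ e × Applicable H C e d₁

    module _ (M₀ : Structure) (model₀ : Model CT M₀) where
      private
        module C₁₀ = CopiesOf a j {V₁} {K₁} {d₁} eq₁ M₀ model₀
        module C₂₀ = CopiesOf a i {V₂} {K₂} {d₂} eq₂ M₀ model₀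

      symbols* : All (λ b → sym b ≡ sym a) K*
      symbols* = ↭ₚ.All-resp-↭ (↭-sym (store↭ emb))
        (Allₚ.++⁺ (Allₚ.map⁺ C₂₀.symbols-≡) C₁₀.symbols-≡)

      -- The bound on heads enters here: `K₁` has `suc j` atoms, enough to serve a whole head. A
      -- longer head could genuinely depend on the atoms contributed by `K₂`.
      redirect : ∀ {k H C B H′ K′ e} → length (toList H) ≤ suc j → K* ↭ H′ ++ K′ →
        Disjoint (fvʳ (rule k H C B)) (V* ++ fvᶜᶠᵍ ⟨ [] , K* , d* ⟩) →
        Equate (toList H) H′ e → Applicable H C e d* → Match H C
      redirect {k} {H} {C} {B} {H′} {K′} {e} H≤ K*↭ disjoint E app =
        H″ , drop m K₁ , proj₁ replaced , ↭-reflexive (≡.sym split) , proj₁ (proj₂ replaced) ,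
        exchange-applicable {k} {H} {C} {B} {H′} {H″} {e} disjoint prefix fv-H″ same-length
          (proj₁ (proj₂ replaced)) (proj₂ (proj₂ replaced)) app
        where
        m : ℕ
        m = length (toList H)

        H″ : List UAtom
        H″ = take m K₁

        split : H″ ++ drop m K₁ ≡ K₁
        split = take++drop≡id m K₁

        same-length : length H′ ≡ length H″
        same-length = ≡.trans (≡.sym (Equate-length E)) (≡.sym (≡.trans (length-take m K₁)
          (m≤n⇒m⊓n≡m (≤-trans H≤ (≤-reflexive (≡.sym C₁₀.length-copies))))))

        prefix : ∀ {P : Pred UAtom 0ℓ} → All P K* → All P H′ × All P H″
        prefix {P} ps =
          Allₚ.++⁻ˡ H′ (↭ₚ.All-resp-↭ K*↭ ps) ,
          Allₚ.++⁻ˡ H″ (subst (All P) (≡.sym split)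
            (Allₚ.++⁻ʳ (map (renᵘ π) K₂) (↭ₚ.All-resp-↭ (store↭ emb) ps)))

        replaced : ∃ λ e′ → Equate (toList H) H″ e′ × (∀ M {u} →
          Pointwise (λ b c → ground M u b ≡ ground M u c) H′ H″ → satᶜ M u e → satᶜ M u e′)
        replaced = Equate-replace E
          (Pointwise-const same-length (proj₁ (prefix symbols*)) (proj₂ (prefix symbols*)))

        fv-H″ : fvᵘ H″ ⊆ fvᵘ K₁
        fv-H″ {z} z∈ = subst (λ K → z ∈ fvᵘ K) split (concatMap-++⁺ˡ _ H″ z∈)

      combined-final : ∀ {P} → All (λ r → List⁺.length (head r) ≤ suc j) P →
        Final P V₁ ⟨ [] , K₁ , d₁ ⟩ → Final P V* ⟨ [] , K* , d* ⟩
      combined-final {P} short final _ step = impossible step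
        where
        apart : ∀ {r} → FreshVariant P V* ⟨ [] , K* , d* ⟩ r →
          Disjoint (fvʳ r) (V* ++ fvᶜᶠᵍ ⟨ [] , K* , d* ⟩)
        apart (_ , _ , _ , _ , disjoint) = disjoint

        head-short : ∀ {k H C B} → FreshVariant P V* ⟨ [] , K* , d* ⟩ (rule k H C B) →
          length (toList H) ≤ suc j
        head-short (rule _ (h ∷ hs) _ _ , ρ , r∈ , ≡.refl , _) =
          ≤-trans (≤-reflexive (cong suc (length-map (renᵘ ρ) hs))) (All.lookup short r∈)

        -- The variables of the smaller configuration all survive in the combined one, so a variant
        -- fresh for the latter is fresh for the former.
        widen : V₁ ++ fvᵘ K₁ ++ fvᶜ d₁ ⊆ V* ++ fvᵘ K* ++ fvᶜ d*
        widen z∈ with ∈-++⁻ V₁ z∈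
        ... | inj₁ z∈V₁ = ∈-++⁺ˡ (V₁⊆V* z∈V₁)
        ... | inj₂ z∈₁ with ∈-++⁻ (fvᵘ K₁) z∈₁
        ...   | inj₁ z∈K₁ = ∈-++⁺ʳ V* (∈-++⁺ˡ (fv-K₁⊆K* z∈K₁))
        ...   | inj₂ z∈d₁ = ∈-++⁺ʳ V* (∈-++⁺ʳ (fvᵘ K*) (fv-d₁⊆d* z∈d₁))

        fresh₁ : ∀ {r} → FreshVariant P V* ⟨ [] , K* , d* ⟩ r → FreshVariant P V₁ ⟨ [] , K₁ , d₁ ⟩ r
        fresh₁ (r₀ , ρ , r∈ , r≡ , disjoint) =
          r₀ , ρ , r∈ , r≡ , λ { (z∈r , z∈) → disjoint (z∈r , widen z∈) }

        impossible : ∀ {c} → ¬ Step P V* ⟨ [] , K* , d* ⟩ c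
        impossible (solve G↭ _)   = ↭ₚ.¬x∷xs↭[] (↭-sym G↭)
        impossible (introduce G↭) = ↭ₚ.¬x∷xs↭[] (↭-sym G↭)
        impossible (simplify {H = H} {C} {B} K↭ fresh E app) = conflict
          (redirect {simplification} {H} {C} {B} (head-short fresh) K↭ (apart fresh) E app)
          where
          conflict : ¬ Match H C
          conflict (_ , _ , _ , K₁↭ , E′ , app′) = final _ (simplify K₁↭ (fresh₁ fresh) E′ app′)
        impossible (propagate {H = H} {C} {B} K↭ fresh E app) = conflict
          (redirect {propagation} {H} {C} {B} (head-short fresh) K↭ (apart fresh) E app)
          where
          conflict : ¬ Match H C
          conflict (_ , _ , _ , K₁↭ , E′ , app′) = final _ (propagate K₁↭ (fresh₁ fresh) E′ app′)

  -- The source program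

  usersOf-↭ : ∀ {G G′} → G ↭ G′ → usersOf G ↭ usersOf G′
  usersOf-↭ refl                           = refl
  usersOf-↭ (prep (builtin _) p)           = usersOf-↭ p
  usersOf-↭ (prep (user _) p)              = prep _ (usersOf-↭ p)
  usersOf-↭ (swap (builtin _) (builtin _) p) = usersOf-↭ p
  usersOf-↭ (swap (builtin _) (user _) p)  = prep _ (usersOf-↭ p)
  usersOf-↭ (swap (user _) (builtin _) p)  = prep _ (usersOf-↭ p)
  usersOf-↭ (swap (user _) (user _) p)     = swap _ _ (usersOf-↭ p)
  usersOf-↭ (trans p q)                    = ↭-trans (usersOf-↭ p) (usersOf-↭ q)

  builtinsOf-↭ : ∀ {G G′} → G ↭ G′ → builtinsOf G ↭ builtinsOf G′
  builtinsOf-↭ refl                           = refl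
  builtinsOf-↭ (prep (builtin _) p)           = prep _ (builtinsOf-↭ p)
  builtinsOf-↭ (prep (user _) p)              = builtinsOf-↭ p
  builtinsOf-↭ (swap (builtin _) (builtin _) p) = swap _ _ (builtinsOf-↭ p)
  builtinsOf-↭ (swap (builtin _) (user _) p)  = prep _ (builtinsOf-↭ p)
  builtinsOf-↭ (swap (user _) (builtin _) p)  = prep _ (builtinsOf-↭ p)
  builtinsOf-↭ (swap (user _) (user _) p)     = builtinsOf-↭ p
  builtinsOf-↭ (trans p q)                    = ↭-trans (builtinsOf-↭ p) (builtinsOf-↭ q)

  usersOf-user : ∀ As → usersOf (map user As) ≡ As
  usersOf-user []       = ≡.refl
  usersOf-user (a ∷ As) = cong (a ∷_) (usersOf-user As)

  ≃-of-⇔ : ∀ V K {d d′} → (∀ M → Model CT M → ∀ {v} → satᶜ M v d ⇔ satᶜ M v d′) →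
    (∃-[ V ] K ∧ d) ≃ (∃-[ V ] K ∧ d′)
  ≃-of-⇔ V K d⇔d′ M model v gs = mk⇔
    (λ (θ , agree , s , p) → θ , agree , Equivalence.to (d⇔d′ M model) s , p)
    (λ (θ , agree , s , p) → θ , agree , Equivalence.from (d⇔d′ M model) s , p)

  ≃-refl : ∀ {x} → x ≃ x
  ≃-refl M model v gs = mk⇔ id id

  ≃-trans : ∀ {x y z} → x ≃ y → y ≃ z → x ≃ z
  ≃-trans p q M model v gs = mk⇔
    (Equivalence.to (q M model v gs) ∘ Equivalence.to (p M model v gs))
    (Equivalence.from (p M model v gs) ∘ Equivalence.from (q M model v gs))

  -- Solved by giving each renamed variable the value of its original; this matches the head of
  -- `idle` with copies of `a`.
  Equate-ren : ∀ π As → ∃ λ e → Equate (map (renᵘ π) As) As e ×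
    (∀ M {u} → AgreeOn (fvᵘ As) (u ∘ to π) u → satᶜ M u e)
  Equate-ren π []       = true , nil , λ _ _ → tt
  Equate-ren π ((p · ts) ∷ As) with Equate-ren π As
  ... | _ , E , sat-E = _ , cons E , λ M agree →
    Equivalence.from (sat-eqs M _ ts) (≡.trans (evals-ren M π ts) (evals-cong M ts (agree ∘ ∈-++⁺ˡ))) ,
    sat-E M (agree ∘ ∈-++⁺ʳ (fvᵗˢ ts))

  module Source (a : UAtom) (n : ℕ) where
    heads : List⁺ UAtom
    heads = a ∷ replicate n a

    -- Propagation removes no user-defined constraint, so an empty store is reached only from goals
    -- made of built-ins. This keeps the data sufficient answers trivial.
    idle : Rule
    idle = rule propagation heads [] []

    program : Program
    program = idle ∷ []

    -- X stands for the freshness condition of FreshVariant, which plays no role in what follows.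
    Variant : Rule → Set → Set
    Variant r X = ∃₂ λ r₀ ρ → r₀ ∈ program × r ≡ renʳ ρ r₀ × X

    no-simplification : ∀ {X H C B} → ¬ Variant (rule simplification H C B) X
    no-simplification (_ , _ , here ≡.refl , () , _)
    no-simplification (_ , _ , there () , _)

    variant-of-idle : ∀ {X H C B} → Variant (rule propagation H C B) X →
      B ≡ [] × length (toList H) ≡ suc n
    variant-of-idle (_ , ρ , here ≡.refl , ≡.refl , _) =
      ≡.refl , cong suc (≡.trans (length-map (renᵘ ρ) (replicate n a)) (length-replicate n))
    variant-of-idle (_ , _ , there () , _)

    matched-length : ∀ {X H′ e H C B} → Variant (rule propagation H C B) X →
      Equate (toList H) H′ e → length H′ ≡ suc n
    matched-length fresh E = ≡.trans (≡.sym (Equate-length E)) (proj₂ (variant-of-idle fresh))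

    module _ {V : List Var} where

      users-invariant : ∀ {G K d G′ K′ d′} → Star (Step program V) ⟨ G , K , d ⟩ ⟨ G′ , K′ , d′ ⟩ →
        usersOf G ++ K ↭ usersOf G′ ++ K′
      users-invariant ε = refl
      users-invariant (solve G↭ _ ◅ run) =
        ↭-trans (↭ₚ.++⁺ʳ _ (usersOf-↭ G↭)) (users-invariant run)
      users-invariant {K = K} (introduce {G′ = G₁} {h = h} G↭ ◅ run) =
        ↭-trans (↭ₚ.++⁺ʳ _ (usersOf-↭ G↭))
          (↭-trans (↭-sym (↭ₚ.shift h (usersOf G₁) K)) (users-invariant run))
      users-invariant (simplify _ fresh _ _ ◅ _) = contradiction fresh no-simplification
      users-invariant {G = G} (propagate K↭ fresh _ _ ◅ run) with variant-of-idle fresh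
      ... | ≡.refl , _ = ↭-trans (↭ₚ.++⁺ˡ (usersOf G) K↭) (users-invariant run)

      -- Neither `introduce` nor `propagate` leads to a store that can become empty again, so the
      -- run consists of `solve` steps, which merely conjoin the built-ins of the goal.
      empty-run : ∀ {G K d d′} → Star (Step program V) ⟨ G , K , d ⟩ ⟨ [] , [] , d′ ⟩ →
        K ≡ [] × usersOf G ≡ [] ×
        (∀ M → Model CT M → ∀ {v} → satᶜ M v d′ ⇔ (All (satᶜ M v) (builtinsOf G) × satᶜ M v d))
      empty-run ε = ≡.refl , ≡.refl , λ M model → mk⇔ (λ s → [] , s) proj₂
      empty-run (solve {G} {G′} {c = c} {d} {d₁} G↭ c∧d⇔d₁ ◅ run) with empty-run run
      ... | ≡.refl , no-users , equiv =
        ≡.refl , ↭ₚ.↭-empty-inv (subst (usersOf G ↭_) no-users (usersOf-↭ G↭)) , λ M model {v} →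
          mk⇔ (λ s → let all , s₁ = Equivalence.to (equiv M model) s
                         s-c , s-d = proj₂ (c∧d⇔d₁ M model v) s₁ in
                     ↭ₚ.All-resp-↭ (↭-sym (builtinsOf-↭ G↭)) (s-c ∷ all) , s-d)
              (λ (all , s-d) → case-∷ (↭ₚ.All-resp-↭ (builtinsOf-↭ G↭) all) λ s-c all′ →
                Equivalence.from (equiv M model) (all′ , proj₁ (c∧d⇔d₁ M model v) (s-c , s-d)))
        where
        case-∷ : ∀ {P : Pred Constraint 0ℓ} {x xs} {Z : Set} → All P (x ∷ xs) → (P x → All P xs → Z) → Z
        case-∷ (p ∷ ps) k = k p ps
      empty-run (introduce _ ◅ run) with empty-run run
      ... | () , _
      empty-run (simplify _ fresh _ _ ◅ _) = contradiction fresh no-simplification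
      empty-run (propagate {H′ = H′} _ fresh E _ ◅ run) with empty-run run
      ... | none , _ with H′ | matched-length fresh E
      ...   | []    | ()
      ...   | _ ∷ _ | _ with () ← none

      introduce-copies : ∀ k j → Star (Step program V)
        ⟨ copies a k , replicate j a , true ⟩ ⟨ [] , replicate (k + j) a , true ⟩
      introduce-copies zero    j = ε
      introduce-copies (suc k) j = introduce refl ◅
        subst (λ i → Star (Step program V) ⟨ copies a k , replicate (suc j) a , true ⟩ ⟨ [] , replicate i a , true ⟩)
          (+-suc k j)
          (introduce-copies k (suc j))

      few-copies-final : ∀ {k} → k ≤ n → Final program V ⟨ [] , replicate k a , true ⟩
      few-copies-final k≤n _ (solve G↭ _)   = ↭ₚ.¬x∷xs↭[] (↭-sym G↭)
      few-copies-final k≤n _ (introduce G↭) = ↭ₚ.¬x∷xs↭[] (↭-sym G↭)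
      few-copies-final k≤n _ (simplify _ fresh _ _) = no-simplification fresh
      few-copies-final {k} k≤n _ (propagate {H′ = H′} {K′} K↭ fresh E _) = <⇒≱ (s≤s k≤n) (begin
        suc n                     ≡⟨ matched-length fresh E ⟨
        length H′                 ≤⟨ m≤m+n (length H′) (length K′) ⟩
        length H′ + length K′     ≡⟨ length-++ H′ ⟨
        length (H′ ++ K′)         ≡⟨ ↭ₚ.↭-length K↭ ⟨
        length (replicate k a)    ≡⟨ length-replicate k ⟩
        k                         ∎)
        where open ≤-Reasoning

      module _ {π : Var ↔ Var} {K : List UAtom} {d : Constraint}
               (K↭ : K ↭ toList heads)
               (apart : ∀ {y} → y ∈ fvᵘ (toList heads) → to π y ∉ V ++ fvᵘ K ++ fvᶜ d) where
        private
          xs : List Var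
          xs = fvᵘ (map (renᵘ π) (toList heads))

          xs-fresh : ∀ {z} → z ∈ xs → z ∉ V ++ fvᵘ K ++ fvᶜ d
          xs-fresh {z} z∈ with ∈-map⁻ (to π) (subst (z ∈_) (fv-renᵘ π (toList heads)) z∈)
          ... | y , y∈ , ≡.refl = apart y∈

        idle-fresh : FreshVariant program V ⟨ [] , K , d ⟩ (renʳ π idle)
        idle-fresh = idle , π , here ≡.refl , ≡.refl , λ (z∈r , z∈c) →
          [ (λ z∈ → xs-fresh z∈ z∈c) , (λ ()) ]′ (∈-++⁻ xs z∈r)

        idle-applicable : ∀ {e} → (∀ M {u} → AgreeOn (fvᵘ (toList heads)) (u ∘ to π) u → satᶜ M u e) →
          Applicable (List⁺.map (renᵘ π) heads) [] e d
        idle-applicable sat-e M _ v _ = ∃ᶜ*-intro M xs _ (override-∉ xs) (sat-e M agree , tt)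
          where
          u : Valuation M
          -- Renamed head variables receive the values of their originals. The originals occur in
          -- `K`, which the renaming avoids, so they keep their own values.
          u = override xs v (v ∘ Inverse.from π)

          agree : AgreeOn (fvᵘ (toList heads)) (u ∘ to π) u
          agree {y} y∈ = begin
            u (to π y)
              ≡⟨ override-∈ xs (subst (to π y ∈_) (≡.sym (fv-renᵘ π (toList heads))) (∈-map⁺ (to π) y∈)) ⟩
            v (Inverse.from π (to π y))
              ≡⟨ cong v (Inverse.strictlyInverseʳ π y) ⟩
            v y
              ≡⟨ override-∉ xs (λ y∈xs → xs-fresh y∈xs (∈-++⁺ʳ V (∈-++⁺ˡ (concatMap-⊆ _ (↭-sym K↭) y∈)))) ⟨
            u y ∎
            where open ≡.≡-Reasoning

        idle-step : Step program V ⟨ [] , K , d ⟩ ⟨ [] , toList heads ++ [] , proj₁ (Equate-ren π (toList heads)) ∧ᶜ d ⟩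
        idle-step = propagate {H = List⁺.map (renᵘ π) heads} {[]} {[]}
          (↭-trans K↭ (↭-reflexive (≡.sym (++-identityʳ (toList heads)))))
          idle-fresh (proj₁ (proj₂ (Equate-ren π (toList heads))))
          (idle-applicable (proj₂ (proj₂ (Equate-ren π (toList heads)))))

      -- The head equations are solvable under every valuation and the guard is empty, so whatever
      -- `d` has become, a configuration storing all copies is not final.
      idle-applies : ∀ {K} d → K ↭ toList heads → ∃ (Step program V ⟨ [] , K , d ⟩)
      idle-applies {K} d K↭ with renaming-apart [] (fvᵘ (toList heads)) (V ++ fvᵘ K ++ fvᶜ d)
      ... | π , _ , apart = _ , idle-step {π = π} K↭ (λ y∈ → apart y∈ (λ ()))

    only-trivial : ∀ Π → OnlyTrivial Π program
    only-trivial Π G _ b (d , run , _ , b≃) with empty-run run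
    ... | _ , no-users , equiv = ≃-trans {b} {∃-[ fvᵍ G ] [] ∧ d} {goalAnswer G} b≃
      (subst (λ K → (∃-[ fvᵍ G ] [] ∧ d) ≃ (∃-[ fvᵍ G ] K ∧ conj (builtinsOf G))) (≡.sym no-users)
        (≃-of-⇔ (fvᵍ G) [] {d} {conj (builtinsOf G)} λ M model → mk⇔
          (λ s → Equivalence.from (sat-conj M (builtinsOf G)) (proj₁ (Equivalence.to (equiv M model) s)))
          (λ s → Equivalence.from (equiv M model) (Equivalence.to (sat-conj M (builtinsOf G)) s , tt))))

    answer-few : ∀ {k} → k ≤ n → QA program (copies a k) (copiesAnswer a k)
    answer-few {k} k≤n = replicate k a , true ,
      subst (λ i → Star (Step program (fvᵍ (copies a k))) ⟨ copies a k , [] , true ⟩ ⟨ [] , replicate i a , true ⟩)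
        (+-identityʳ k) (introduce-copies k 0) ,
      few-copies-final k≤n , ≃-refl {copiesAnswer a k}

    run-users : ∀ As {V K d} → Star (Step program V) ⟨ map user As , [] , true ⟩ ⟨ [] , K , d ⟩ → K ↭ As
    run-users As {V} run = ↭-trans (↭-sym (users-invariant {V} {map user As} run))
      (↭-reflexive (≡.trans (++-identityʳ _) (usersOf-user As)))

    no-answer : ∀ b → ¬ QA program (copies a (suc n)) b
    no-answer b (K , d , run , final , _) = conflict (idle-applies d (run-users (toList heads) run))
      where
      conflict : ¬ ∃ (Step program (fvᵍ (copies a (suc n))) ⟨ [] , K , d ⟩)
      conflict (c , step) = final c step

  -- Refuting an encoding

  module _ {ℓ} (Src Tgt : Pred User 0ℓ) (n : ℕ) (𝒢 : Pred Goal ℓ)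
           (subheads : ContainsSubheads (CHRₙ,ₜ Src (suc (suc n))) 𝒢)
           (encoding : AcceptableEncodingQA (CHRₙ,ₜ Src (suc (suc n))) (CHRₙ Tgt (suc n)) 𝒢)
           (a : UAtom) (a∈ : Src (sym a)) where
    open AcceptableEncodingQA encoding
    -- The parameter counts the copies beyond the first: the head has `suc (suc n)` atoms, against
    -- at most `suc n` in the target.
    open Source a (suc n)

    private
      source-ok : IsProgram (CHRₙ,ₜ Src (suc (suc n))) program
      source-ok =
        ((Allₚ.replicate⁺ (suc (suc n)) a∈ , []) ,
         ≤-reflexive (cong (suc ∘ suc) (length-replicate n))) ∷ [] ,
        only-trivial Src

      copies-ok : ∀ k → IsGoal (CHRₙ,ₜ Src (suc (suc n))) (copies a k)
      copies-ok k = Allₚ.map⁺ (Allₚ.replicate⁺ k a∈)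

      target : Program
      target = proj₁ ⟦ program , source-ok ⟧

      target-short : All (λ r → List⁺.length (head r) ≤ suc n) target
      target-short = All.map proj₂ (lower (proj₂ ⟦ program , source-ok ⟧))

      encoded : ℕ → Goal
      encoded k = proj₁ ⟦ copies a k , copies-ok k ⟧ᵍ

      encoded-suc : ∀ k → encoded (suc k) ↭ encoded 1 ++ encoded k
      encoded-suc k = compositional (copies a 1) (copies a k) (copies-ok 1) (copies-ok k) (copies-ok (suc k))

      replicate-++ : ∀ k l → replicate (k + l) a ≡ replicate k a ++ replicate l a
      replicate-++ zero    l = ≡.refl
      replicate-++ (suc k) l = cong (a ∷_) (replicate-++ k l)

      copies-∈𝒢 : ∀ {k} → k ≤ suc (suc n) → 𝒢 (copies a k)
      copies-∈𝒢 {k} k≤ = subheads program source-ok idle (here ≡.refl)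
        (replicate k a) (replicate (suc (suc n) ∸ k) a)
        (↭-reflexive (≡.trans (cong (λ i → replicate i a) (≡.sym (m+[n∸m]≡n k≤))) (replicate-++ k _)))

      target-answer : ∀ {k} → k ≤ suc n → QA target (encoded k) (copiesAnswer a k)
      target-answer {k} k≤ = Equivalence.to
        (preserves-QA (program , source-ok) (copies a k , copies-ok k)
          (copies-∈𝒢 (≤-trans k≤ (n≤1+n _))) (copiesAnswer a k))
        (answer-few k≤)

      no-target-answer : ∀ b → ¬ QA target (encoded (suc (suc n))) b
      no-target-answer b b∈ = no-answer b (Equivalence.from
        (preserves-QA (program , source-ok) (copies a (suc (suc n)) , copies-ok (suc (suc n)))
          (copies-∈𝒢 ≤-refl) b) b∈)

      -- `encoded 1` is already a part of `encoded (suc n)`, so one more copy adds no goal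
      -- variables: `V₁` and `V*` have the same elements. Hence the first run is replayed without
      -- any renaming.
      fv-one⊆ : fvᵍ (encoded 1) ⊆ fvᵍ (encoded (suc n))
      fv-one⊆ z∈ = concatMap-⊆ fvⁱ (↭-sym (encoded-suc n)) (concatMap-++⁺ˡ fvⁱ (encoded 1) z∈)

      fv-all⊆ : fvᵍ (encoded (suc (suc n))) ⊆ fvᵍ (encoded (suc n))
      fv-all⊆ z∈ = [ fv-one⊆ , id ]′ (∈-++⁻ (fvᵍ (encoded 1))
        (concatMap-++⁻ fvⁱ (encoded 1) (concatMap-⊆ fvⁱ (encoded-suc (suc n)) z∈)))

      ⊆fv-all : fvᵍ (encoded (suc n)) ⊆ fvᵍ (encoded (suc (suc n)))
      ⊆fv-all z∈ = concatMap-⊆ fvⁱ (↭-sym (encoded-suc (suc n))) (concatMap-++⁺ʳ fvⁱ (encoded 1) z∈)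

      V₁ V₂ V* : List Var
      V₁ = fvᵍ (encoded (suc n))
      V₂ = fvᵍ (encoded 1)
      V* = fvᵍ (encoded (suc (suc n)))

      first-run : ∀ {K d} →
        Star (Step target V₁) ⟨ encoded (suc n) , [] , true ⟩ ⟨ [] , K , d ⟩ →
        ∃ λ c → Star (Step target V*) ⟨ encoded (suc (suc n)) , [] , true ⟩ c ×
          Embeds (↔-id Var) (encoded 1) [] true ⟨ [] , K , d ⟩ c
      first-run run = embeds-run {V′ = V*} run start apart
        where
        start : Embeds (↔-id Var) (encoded 1) [] true
          ⟨ encoded (suc n) , [] , true ⟩ ⟨ encoded (suc (suc n)) , [] , true ⟩
        start = record
          { items-renamed = fixed-Renamed* (↔-id Var) (encoded (suc n)) (λ _ → ≡.refl)
          ; goal↭  = ↭-trans (encoded-suc (suc n)) (↭ₚ.++-comm (encoded 1) (encoded (suc n)))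
          ; store↭ = refl
          ; built⇔ = λ _ _ → mk⇔ (λ _ → tt , tt) (λ _ → tt)
          ; built⊆ = λ ()
          ; built⊇ = λ ()
          }

        apart : ∀ {y} → y ∈ runVars run → y ∉ V₁ → y ∉ V* ++ V₂ ++ []
        apart {y} _ y∉ y∈ = y∉ ([ fv-all⊆ , (λ y∈V₂ → fv-one⊆ (subst (y ∈_) (++-identityʳ V₂) y∈V₂)) ]′
          (∈-++⁻ V* y∈))

      ren-id : ∀ K → map (renᵘ (↔-id Var)) K ≡ K
      ren-id []             = ≡.refl
      ren-id ((p · ts) ∷ K) = cong₂ _∷_ (cong (p ·_) (ren-fixᵗˢ (↔-id Var) ts (λ _ → ≡.refl))) (ren-id K)

      -- The roles are exchanged: the copy carried along by the first run becomes the goal to be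
      -- run, and the result of the first run becomes the surroundings.
      second-start : ∀ {π K d c} → AgreeOn V₂ (to π) id →
        Embeds (↔-id Var) (encoded 1) [] true ⟨ [] , K , d ⟩ c →
        Embeds π [] K d ⟨ encoded 1 , [] , true ⟩ c
      second-start {π} {K} {d} {c} fix emb = record
        { items-renamed = fixed-Renamed* π (encoded 1) fix
        ; goal↭  = ↭-trans (no-items (items-renamed emb) (goal↭ emb))
                           (↭-reflexive (≡.sym (++-identityʳ (encoded 1))))
        ; store↭ = ↭-trans (store↭ emb) (↭-reflexive (≡.trans (++-identityʳ _) (ren-id K)))
        ; built⇔ = λ M model → mk⇔
            (λ s → tt , proj₁ (Equivalence.to (built⇔ emb M model) s))
            (λ s → Equivalence.from (built⇔ emb M model) (proj₂ s , tt))
        ; built⊆ = λ {z} z∈ → subst (z ∈_) fv-d (built⊆ emb z∈)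
        ; built⊇ = λ {z} z∈ → built⊇ emb (subst (z ∈_) (≡.sym fv-d) z∈)
        }
        where
        fv-d : map id (fvᶜ d) ++ [] ≡ fvᶜ d
        fv-d = ≡.trans (++-identityʳ _) (map-id (fvᶜ d))

        no-items : ∀ {π items G G′} → Pointwise (Renamed π) [] items → G ↭ items ++ G′ → G ↭ G′
        no-items [] p = p

    encoding-refuted : ∀ M → ¬ Model CT M
    encoding-refuted M₀ model₀ = refute (target-answer ≤-refl) (target-answer {1} (s≤s z≤n))
      where
      module _ {K₁ K₂ : List UAtom} {d₁ d₂ : Constraint}
               (final₁ : Final target V₁ ⟨ [] , K₁ , d₁ ⟩)
               (eq₁ : copiesAnswer a (suc n) ≃ (∃-[ V₁ ] K₁ ∧ d₁))
               (run₂ : Star (Step target V₂) ⟨ encoded 1 , [] , true ⟩ ⟨ [] , K₂ , d₂ ⟩)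
               (eq₂ : copiesAnswer a 1 ≃ (∃-[ V₂ ] K₂ ∧ d₂)) where

        conclude : ∀ {π c c*} → AgreeOn V₂ (to π) id →
          (∀ {x} → x ∈ fvᶜ d₂ → x ∉ V₂ → to π x ∉ fvᵘ K₁ ++ fvᶜ d₁) →
          Star (Step target V*) ⟨ encoded (suc (suc n)) , [] , true ⟩ c →
          Star (Step target V*) c c* → ¬ Embeds π [] K₁ d₁ ⟨ [] , K₂ , d₂ ⟩ c*
        conclude {c* = ⟨ G , K , d ⟩} fix apart run run* emb@(record { items-renamed = [] })
          with ≡.refl ← ↭ₚ.↭-empty-inv (goal↭ emb) =
          no-target-answer (∃-[ V* ] K ∧ d)
            ( K , d , run ◅◅ run*
            , combined-final eq₁ eq₂ ⊆fv-all fix apart emb M₀ model₀ target-short final₁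
            , ≃-refl {∃-[ V* ] K ∧ d})

        second-run : ∀ {c} → Star (Step target V*) ⟨ encoded (suc (suc n)) , [] , true ⟩ c →
          ¬ Embeds (↔-id Var) (encoded 1) [] true ⟨ [] , K₁ , d₁ ⟩ c
        second-run run emb
          -- `fvᶜ d₂` is listed besides the rule variables because a `solve` step may bring in
          -- variables of its own.
          with renaming-apart V₂ (runVars run₂ ++ fvᶜ d₂) (V* ++ fvᵘ K₁ ++ fvᶜ d₁)
        ... | π , fix , apart
          with embeds-run {V′ = V*} run₂ (second-start {π} fix emb) (λ y∈ → apart (∈-++⁺ˡ y∈))
        ...   | _ , run* , emb* = conclude {π} fix
          (λ x∈ x∉ πx∈ → apart (∈-++⁺ʳ (runVars run₂) x∈) x∉ (∈-++⁺ʳ V* πx∈)) run run* emb*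

      refute : QA target (encoded (suc n)) (copiesAnswer a (suc n)) →
               ¬ QA target (encoded 1) (copiesAnswer a 1)
      refute (_ , _ , run₁ , final₁ , eq₁) (_ , _ , run₂ , _ , eq₂) with first-run run₁
      ... | _ , run , emb = second-run final₁ eq₁ run₂ eq₂ run emb

theorem5p2 : (S : Signature) (CT : Syntax.Theory S) → let open CHR S CT in
    Consistent CT →
    (Src Tgt : Pred (Signature.User S) 0ℓ) → ∃ Src →
    (n : ℕ) → 1 < n →
    ∀ {ℓ} (𝒢 : Pred Goal ℓ) → ContainsSubheads (CHRₙ,ₜ Src (suc n)) 𝒢 →
    ¬ AcceptableEncodingQA (CHRₙ,ₜ Src (suc n)) (CHRₙ Tgt n) 𝒢
theorem5p2 S CT consistent Src Tgt (p , p∈) (suc n) _ 𝒢 subheads encoding =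
  -- Consistency yields no model outright, only that not every model is impossible; since a
  -- contradiction is sought, refuting each model is enough.
  consistent λ M model _ → encoding-refuted S CT Src Tgt n 𝒢 subheads encoding
    -- Repeating one variable gives an atom of `p` whatever its arity.
    (p Syntax.· Vec.replicate _ (Syntax.var 0)) p∈ M model
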